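{- Let $C$ and $C'$ be maximal caps in $AG(4,3)$ forming a 1-completable pair, and let $C'=C_1\cup R_1$ be the decomposition of $C'$ into two disjoint demicaps that corresponds to $C$, i.e. $C$ is exactly the set of points completing exactly one line with a pair of points of $C_1$ and exactly one line with a pair of points of $R_1$. The demicap $C_1$ is contained in exactly six maximal caps; let $R_1,\dots,R_6$ be the complements of $C_1$ in these six maximal caps. Similarly, let $C_1,\dots,C_6$ be the complements of $R_1$ in the six maximal caps containing $R_1$. Then for all $1\le i,j\le 6$, $R_i\cup C_j$ is a maximal cap, and the set $\{R_i\cup C_j : 1\le i,j\le 6\}$ is exactly the set of 36 maximal caps that form a 1-completable pair with $C$.
   Context: $AG(4,3)=\mathbb{F}_3^4$ with lines the triples of distinct points $x,y,z$ with $x+y+z=0$. A cap is a set of points containing no line; a maximal cap is a cap of largest size (20 points in $AG(4,3)$), and each has a unique anchor point $a\notin C$ such that $C$ is the union of 10 pairs $\{b,c\}$ with $\{a,b,c\}$ a line. A hyperplane is a 3-dimensional affine subspace. For a point $a$, an $a$-line is a pair $\{b,c\}$ with $\{a,b,c\}$ a line. A demicap with anchor point $a$ is a cap consisting of five $a$-lines such that no four of the corresponding lines through $a$ lie in a common hyperplane. A point $p\notin S$ completes a line with a pair of points of $S$ if $\{p,x,y\}$ is a line for some $x,y\in S$; the number of such lines is the number of such pairs. A partition of $AG(4,3)$ here means a partition into a single point $a$ and four pairwise disjoint maximal caps each with anchor point $a$. Two disjoint maximal caps form a $k$-completable pair if they appear together in exactly $k$ such partitions. Every maximal cap $C'$ forming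 a 1-completable pair with $C$ has a unique decomposition into two disjoint demicaps for which the set of points completing exactly one line with pairs from each demicap is $C$. -}

module Defs where

open import Data.Nat using (ℕ; _≤_; ⌊_/2⌋)
open import Data.Fin using (Fin; zero; suc)
open import Data.Fin.Properties using () renaming (_≟_ to _≟F_)
open import Data.Vec using (Vec; []; _∷_; zipWith; replicate; map)
open import Data.Vec.Properties using (≡-dec)
open import Data.List using (List; []; _∷_; concatMap; filterᵇ; length)
import Data.List as L
open import Data.Bool using (Bool; true; false; _∧_; not)
open import Data.Product using (Σ; _×_; _,_)
open import Data.Sum using (_⊎_)
open import Relation.Nullary using (¬_; Dec; yes; no; does)
open import Relation.Binary.PropositionalEquality using (_≡_; _≢_)

F3 : Set
F3 = Fin 3

infixl 6 _+₃_
_+₃_ : F3 → F3 → F3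
zero +₃ y = y
suc zero +₃ zero = suc zero
suc zero +₃ suc zero = suc (suc zero)
suc zero +₃ suc (suc zero) = zero
suc (suc zero) +₃ zero = suc (suc zero)
suc (suc zero) +₃ suc zero = zero
suc (suc zero) +₃ suc (suc zero) = suc zero

infixl 7 _*₃_
_*₃_ : F3 → F3 → F3
zero *₃ y = zero
suc zero *₃ y = y
suc (suc zero) *₃ zero = zero
suc (suc zero) *₃ suc zero = suc (suc zero)
suc (suc zero) *₃ suc (suc zero) = suc zero

-₃_ : F3 → F3
-₃ zero = zero
-₃ suc zero = suc (suc zero)
-₃ suc (suc zero) = suc zero

Point : Set
Point = Vec F3 4

0ₚ : Point
0ₚ = replicate 4 zero

infixl 6 _⊕_
_⊕_ : Point → Point → Point
_⊕_ = zipWith _+₃_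

infixl 7 _·_
_·_ : F3 → Point → Point
s · x = map (s *₃_) x

⊖_ : Point → Point
⊖ x = map -₃_ x

_≟ₚ_ : (x y : Point) → Dec (x ≡ y)
_≟ₚ_ = ≡-dec _≟F_

allVecs : (n : ℕ) → List (Vec F3 n)
allVecs ℕ.zero = [] ∷ []
allVecs (ℕ.suc n) = concatMap (λ x → L.map (x ∷_) (allVecs n)) (L.allFin 3)

allPoints : List Point
allPoints = allVecs 4

IsLine : Point → Point → Point → Set
IsLine x y z = x ≢ y × y ≢ z × x ≢ z × (x ⊕ y ⊕ z ≡ 0ₚ)

third : Point → Point → Point
third x y = ⊖ (x ⊕ y)

PSet : Set
PSet = Point → Bool

infix 4 _∈ₚ_ _∉ₚ_ _≐_ _⊆ₚ_
_∈ₚ_ : Point → PSet → Set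
p ∈ₚ S = S p ≡ true

_∉ₚ_ : Point → PSet → Set
p ∉ₚ S = ¬ (p ∈ₚ S)

_≐_ : PSet → PSet → Set
S ≐ T = ∀ p → S p ≡ T p

_⊆ₚ_ : PSet → PSet → Set
S ⊆ₚ T = ∀ p → p ∈ₚ S → p ∈ₚ T

infixl 6 _∪ₚ_
_∪ₚ_ : PSet → PSet → PSet
(S ∪ₚ T) p = Data.Bool._∨_ (S p) (T p)

Disjoint : PSet → PSet → Set
Disjoint S T = ∀ p → p ∈ₚ S → p ∉ₚ T

size : PSet → ℕ
size S = length (filterᵇ S allPoints)

Cap : PSet → Set
Cap S = ∀ x y z → IsLine x y z → ¬ (x ∈ₚ S × y ∈ₚ S × z ∈ₚ S)

MaxCap : PSet → Set
MaxCap S = Cap S × (∀ T → Cap T → size T ≤ size S)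

-- a is an anchor point of C: a ∉ C and C is a union of a-lines
-- (the a-line through b ∈ C is {b, third a b})
Anchor : Point → PSet → Set
Anchor a C = a ∉ₚ C × (∀ b → b ∈ₚ C → third a b ∈ₚ C)

Partition : Point → PSet → PSet → PSet → PSet → Set
Partition a C₁ C₂ C₃ C₄ =
  (MaxCap C₁ × MaxCap C₂ × MaxCap C₃ × MaxCap C₄) ×
  (Anchor a C₁ × Anchor a C₂ × Anchor a C₃ × Anchor a C₄) ×
  (Disjoint C₁ C₂ × Disjoint C₁ C₃ × Disjoint C₁ C₄ ×
   Disjoint C₂ C₃ × Disjoint C₂ C₄ × Disjoint C₃ C₄) ×
  (∀ p → p ≡ a ⊎ p ∈ₚ C₁ ⊎ p ∈ₚ C₂ ⊎ p ∈ₚ C₃ ⊎ p ∈ₚ C₄)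

-- C and C' appear together in exactly one partition (partitions being
-- a point together with an unordered set of four caps)
OneCompletable : PSet → PSet → Set
OneCompletable C C' =
  Σ Point λ a → Σ PSet λ D → Σ PSet λ E →
    Partition a C C' D E ×
    (∀ a' D' E' → Partition a' C C' D' E' →
       (D' ≐ D × E' ≐ E) ⊎ (D' ≐ E × E' ≐ D))

record Hyperplane : Set where
  field
    origin u v w : Point
    indep : ∀ s t r → s · u ⊕ t · v ⊕ r · w ≡ 0ₚ →
            s ≡ zero × t ≡ zero × r ≡ zero

_∈H_ : Point → Hyperplane → Set
p ∈H H = Σ F3 λ s → Σ F3 λ t → Σ F3 λ r →
           p ≡ origin ⊕ s · u ⊕ t · v ⊕ r · w
  where open Hyperplane H

-- demicap with anchor a: a cap consisting of five a-lines, no four of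
-- whose lines through a lie in a common hyperplane
Demicap : Point → PSet → Set
Demicap a S =
  Cap S × Anchor a S × size S ≡ 10 ×
  (∀ (H : Hyperplane) (b : Fin 4 → Point) →
     (∀ i → b i ∈ₚ S) →
     (∀ i j → i ≢ j → b i ≢ b j × b i ≢ third a (b j)) →
     ¬ (∀ i → a ∈H H × b i ∈H H × third a (b i) ∈H H))

IsDemicap : PSet → Set
IsDemicap S = Σ Point λ a → Demicap a S

-- number of (unordered) pairs {x,y} ⊆ S with {p,x,y} a line
-- (counted via ordered pairs (x, third p x), then halved)
lineCount : PSet → Point → ℕ
lineCount S p = ⌊ length (filterᵇ ok allPoints) /2⌋
  where
  ok : Point → Bool
  ok x = S x ∧ S (third p x) ∧ not (does (p ≟ₚ x)) ∧
         not (does (x ≟ₚ third p x)) ∧ not (does (p ≟ₚ third p x))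

CompletesExactlyOne : PSet → Point → Set
CompletesExactlyOne S p = p ∉ₚ S × lineCount S p ≡ 1

CorrespondingDecomposition : PSet → PSet → PSet → PSet → Set
CorrespondingDecomposition C C' C₁ R₁ =
  IsDemicap C₁ × IsDemicap R₁ × Disjoint C₁ R₁ × C' ≐ C₁ ∪ₚ R₁ ×
  (∀ p → p ∈ₚ C → (CompletesExactlyOne C₁ p × CompletesExactlyOne R₁ p)) ×
  (∀ p → CompletesExactlyOne C₁ p → CompletesExactlyOne R₁ p → p ∈ₚ C)

SixCompletions : PSet → PSet → (Fin 6 → PSet) → Set
SixCompletions S T Ms =
  Ms zero ≐ T ×
  (∀ i → MaxCap (S ∪ₚ Ms i) × Disjoint S (Ms i)) ×
  (∀ i j → i ≢ j → ¬ (Ms i ≐ Ms j)) ×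
  (∀ M → MaxCap M → S ⊆ₚ M → Σ (Fin 6) λ i → M ≐ S ∪ₚ Ms i)

{-
A maximal cap with its anchor moved to the origin is symmetric under negation and amounts to ten
points of PG(3,3), no three collinear (an ovoid). In linear coordinates chosen so that C contains
the standard basis, an exhaustive search leaves 24 ovoids, all images of one of them, c₀, under
monomial matrices; hence C = c₀ without loss of generality. A second search finds all ovoids
disjoint from c₀. Each completes a partition together with the ovoids disjoint from both it and c₀,
and there are exactly two of these for 36 ovoids and at least three for the others, so these 36
are the 1-completable partners of c₀. They are the unions of one demicap from each of two families
of six, and isometries of c₀ permute them transitively; hence C′ is a fixed set too. Its demicap
decomposition is unique up to order, an isometry of c₀ exchanges its two halves, and a third search,
among all affine caps, finds the maximal caps containing either half.
-}
module Submission where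

open import Defs
open import Data.Bool using (Bool; true; false; _∧_; _∨_; not; _xor_; if_then_else_; T; T?)
import Data.Bool as Bool
open import Data.Bool.ListAction using (all; any)
open import Data.Bool.Properties using (T-≡; ∨-comm)
open import Data.Empty using (⊥; ⊥-elim)
open import Data.Fin using (Fin; zero; suc)
open import Data.Fin.Properties using (all?; injective⇒≤) renaming (_≟_ to _≟F_)
open import Data.List using (List; []; _∷_; _++_; allFin; concatMap; filterᵇ; length; lookup)
import Data.List as L
import Data.List.Membership.DecPropositional as DecMembership
open import Data.List.Membership.Propositional using (_∈_; find)
open import Data.List.Membership.Propositional.Properties
  using (∈-allFin; ∈-concat⁺′; ∈-filter⁺; ∈-filter⁻; ∈-lookup; ∈-map⁺; ∈-map⁻)
import Data.List.Properties as Lₚ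
open import Data.List.Relation.Unary.All using (All; []; _∷_)
import Data.List.Relation.Unary.All as All
import Data.List.Relation.Unary.All.Properties as Allₚ
open import Data.List.Relation.Unary.Any using (Any; here; there; index)
import Data.List.Relation.Unary.Any as Any
import Data.List.Relation.Unary.Any.Properties as Anyₚ
open import Data.List.Relation.Unary.Unique.DecPropositional using (unique?)
open import Data.List.Relation.Unary.Unique.Propositional using (Unique; []; _∷_)
import Data.List.Relation.Unary.Unique.Propositional.Properties as Uniqueₚ
open import Data.Nat using (ℕ; _≤_; _<_; _<ᵇ_; _≡ᵇ_; _+_; _∸_; _/_; _%_; ⌊_/2⌋; s≤s)
import Data.Nat.Properties as ℕₚ
open import Data.Product using (Σ; ∃; ∃₂; _×_; _,_; proj₁; proj₂)
open import Data.Sum using (_⊎_; inj₁; inj₂; [_,_]′) renaming (map to ⊎-map)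
open import Data.Vec using (Vec; []; _∷_; map; replicate; zipWith)
import Data.Vec as V
open import Data.Vec.Properties using (∷-injective)
open import Function using (_∘_; id)
open import Function.Bundles using (Equivalence)
open import Relation.Binary.Definitions using (DecidableEquality; tri<; tri≈; tri>)
open import Relation.Binary.PropositionalEquality
  using (_≡_; _≢_; refl; sym; trans; cong; cong₂; subst; subst₂; module ≡-Reasoning)
open import Relation.Nullary using (¬_; Dec; yes; no; contradiction; does)
open import Relation.Nullary.Decidable using (from-yes; _→-dec_; _×-dec_; ¬?)

-- Neither the size 20 of a maximal cap nor the uniqueness of its anchor is taken as known. The
-- partition in the hypothesis divides the 80 points other than its anchor among four maximal caps,
-- which have equal sizes; so `C` has 20 points, and its maximality bounds every cap. Uniqueness of
-- the anchor is computed for `c₀` alone. This suffices because all caps of a partition share their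
-- anchor, so every cap that occurs in a partition with `c₀` is visible to a search in PG(3,3). A
-- maximal cap that merely contains a demicap comes with no anchor, which is why the third search
-- runs over all 81 affine points. The type checker runs the searches. Each is used through a
-- completeness lemma, by which every set meeting the constraints turns up, and through Boolean
-- tests of the finitely many results. The properties to be transported are expressed through
-- `third` and counting, hence are invariant under affine bijections.

private
  variable
    A : Set
    n k : ℕ

-- Lists without repetitions, and the third point of a line

≡⇒T : ∀ {b} → b ≡ true → T b
≡⇒T = Equivalence.from T-≡

T⇒≡ : ∀ {b} → T b → b ≡ true
T⇒≡ = Equivalence.to T-≡

∈-filterᵇ⁺ : ∀ (P : A → Bool) {x xs} → x ∈ xs → P x ≡ true → x ∈ filterᵇ P xs
∈-filterᵇ⁺ P x∈xs Px = ∈-filter⁺ (T? ∘ P) x∈xs (≡⇒T Px)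

∈-filterᵇ⁻ : ∀ (P : A → Bool) {x} xs → x ∈ filterᵇ P xs → x ∈ xs × P x ≡ true
∈-filterᵇ⁻ P xs x∈ with ∈-filter⁻ (T? ∘ P) {xs = xs} x∈
... | x∈xs , TPx = x∈xs , T⇒≡ TPx

lookup-injective : ∀ {xs : List A} → Unique xs → ∀ i j → lookup xs i ≡ lookup xs j → i ≡ j
lookup-injective (_ ∷ _) zero zero _ = refl
lookup-injective (x∉ ∷ _) zero (suc j) eq = contradiction eq (All.lookup x∉ (∈-lookup j))
lookup-injective (x∉ ∷ _) (suc i) zero eq = contradiction (sym eq) (All.lookup x∉ (∈-lookup i))
lookup-injective (_ ∷ uniq) (suc i) (suc j) eq = cong suc (lookup-injective uniq i j eq)

-- Pigeonhole principle: sending an index of `xs` to the position of that entry in `ys` is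
-- injective. Comparisons of sizes, and the surjectivity of injective maps, rest on it.
unique-⊆⇒length≤ : ∀ {xs ys : List A} → Unique xs →
  (∀ {x} → x ∈ xs → x ∈ ys) → length xs ≤ length ys
unique-⊆⇒length≤ {xs = xs} {ys} uniq sub = injective⇒≤ {f = position} position-injective
  where
  position : Fin (length xs) → Fin (length ys)
  position i = index (sub (∈-lookup i))
  at-position : ∀ i → lookup xs i ≡ lookup ys (position i)
  at-position i = Anyₚ.lookup-index (sub (∈-lookup i))
  position-injective : ∀ {i j} → position i ≡ position j → i ≡ j
  position-injective {i} {j} eq = lookup-injective uniq i j
    (trans (at-position i) (trans (cong (lookup ys) eq) (sym (at-position j))))

∈-allVecs : (v : Vec F3 n) → v ∈ allVecs n
∈-allVecs [] = here refl
∈-allVecs (x ∷ v) =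
  ∈-concat⁺′ (∈-map⁺ (x ∷_) (∈-allVecs v))
             (∈-map⁺ (λ y → L.map (y ∷_) (allVecs _)) (∈-allFin x))

abstract
  allPoints-unique : Unique allPoints
  allPoints-unique = from-yes (unique? _≟ₚ_ allPoints)

size-≤ : ∀ {S S′ : PSet} (f : Point → Point) → (∀ {p q} → f p ≡ f q → p ≡ q) →
  (∀ p → S p ≡ true → S′ (f p) ≡ true) → size S ≤ size S′
size-≤ {S} {S′} f inj imp = subst (_≤ size S′) (Lₚ.length-map f (filterᵇ S allPoints))
  (unique-⊆⇒length≤ {xs = L.map f (filterᵇ S allPoints)} {ys = filterᵇ S′ allPoints}
    (Uniqueₚ.map⁺ inj (Uniqueₚ.filter⁺ (T? ∘ S) allPoints-unique)) sub)
  where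
  sub : ∀ {q} → q ∈ L.map f (filterᵇ S allPoints) → q ∈ filterᵇ S′ allPoints
  sub q∈ with ∈-map⁻ f q∈
  ... | p , p∈ , refl =
    ∈-filterᵇ⁺ S′ (∈-allVecs _) (imp p (proj₂ (∈-filterᵇ⁻ S allPoints p∈)))

-- Like the other vector identities, this one is stated for every length, so that induction reduces
-- it to a single coordinate, where enumeration of 𝔽₃ decides.
sum-zero⇒third : (x y z : Vec F3 n) → zipWith _+₃_ (zipWith _+₃_ x y) z ≡ replicate n zero →
  z ≡ map -₃_ (zipWith _+₃_ x y)
sum-zero⇒third [] [] [] _ = refl
sum-zero⇒third (x ∷ xs) (y ∷ ys) (z ∷ zs) eq with ∷-injective eq
... | eq₁ , eq₂ = cong₂ _∷_ (coordinate x y z eq₁) (sum-zero⇒third xs ys zs eq₂)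
  where
  coordinate : ∀ x y z → x +₃ y +₃ z ≡ zero → z ≡ -₃ (x +₃ y)
  coordinate = from-yes (all? λ x → all? λ y → all? λ z →
    (x +₃ y +₃ z ≟F zero) →-dec (z ≟F -₃ (x +₃ y)))

third-sum-zero : (x y : Vec F3 n) →
  zipWith _+₃_ (zipWith _+₃_ x y) (map -₃_ (zipWith _+₃_ x y)) ≡ replicate n zero
third-sum-zero [] [] = refl
third-sum-zero (x ∷ xs) (y ∷ ys) = cong₂ _∷_ (coordinate x y) (third-sum-zero xs ys)
  where
  coordinate : ∀ x y → x +₃ y +₃ -₃ (x +₃ y) ≡ zero
  coordinate = from-yes (all? λ x → all? λ y → x +₃ y +₃ -₃ (x +₃ y) ≟F zero)

third-fixedˡ : (x y : Vec F3 n) → x ≡ map -₃_ (zipWith _+₃_ x y) → x ≡ y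
third-fixedˡ [] [] _ = refl
third-fixedˡ (x ∷ xs) (y ∷ ys) eq with ∷-injective eq
... | eq₁ , eq₂ = cong₂ _∷_ (coordinate x y eq₁) (third-fixedˡ xs ys eq₂)
  where
  coordinate : ∀ x y → x ≡ -₃ (x +₃ y) → x ≡ y
  coordinate = from-yes (all? λ x → all? λ y → (x ≟F -₃ (x +₃ y)) →-dec (x ≟F y))

third-fixedʳ : (x y : Vec F3 n) → y ≡ map -₃_ (zipWith _+₃_ x y) → x ≡ y
third-fixedʳ [] [] _ = refl
third-fixedʳ (x ∷ xs) (y ∷ ys) eq with ∷-injective eq
... | eq₁ , eq₂ = cong₂ _∷_ (coordinate x y eq₁) (third-fixedʳ xs ys eq₂)
  where
  coordinate : ∀ x y → y ≡ -₃ (x +₃ y) → x ≡ y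
  coordinate = from-yes (all? λ x → all? λ y → (y ≟F -₃ (x +₃ y)) →-dec (x ≟F y))

-- `IsLine` demands three distinct points, but two distinct points never coincide with their third
-- point: x = -(x + y) already forces x = y over 𝔽₃. Being a cap thus becomes a condition on pairs.
cap-third : ∀ {S x y} → Cap S → x ≢ y → x ∈ₚ S → y ∈ₚ S → third x y ∉ₚ S
cap-third {S} {x} {y} cap x≢y x∈ y∈ z∈ = cap x y (third x y)
  (x≢y , x≢y ∘ third-fixedʳ x y , x≢y ∘ third-fixedˡ x y , third-sum-zero x y) (x∈ , y∈ , z∈)

third-cap : ∀ {S} → (∀ x y → x ≢ y → x ∈ₚ S → y ∈ₚ S → third x y ∉ₚ S) → Cap S
third-cap {S} h x y z (x≢y , _ , _ , sum≡0) (x∈ , y∈ , z∈) =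
  h x y x≢y x∈ y∈ (subst (_∈ₚ S) (sum-zero⇒third x y z sum≡0) z∈)

-- Collineations

-- Over 𝔽₃, the maps preserving third are exactly the affine ones.
record Collineation : Set where
  field
    to from  : Point → Point
    to-from  : ∀ p → to (from p) ≡ p
    from-to  : ∀ p → from (to p) ≡ p
    to-third : ∀ p q → to (third p q) ≡ third (to p) (to q)

  to-injective : ∀ {p q} → to p ≡ to q → p ≡ q
  to-injective {p} {q} eq = trans (sym (from-to p)) (trans (cong from eq) (from-to q))

  from-third : ∀ p q → from (third p q) ≡ third (from p) (from q)
  from-third p q = to-injective (begin
    to (from (third p q))               ≡⟨ to-from _ ⟩
    third p q                           ≡⟨ cong₂ third (to-from p) (to-from q) ⟨
    third (to (from p)) (to (from q))   ≡⟨ to-third _ _ ⟨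
    to (third (from p) (from q))        ∎)
    where open ≡-Reasoning

open Collineation

infix 9 _⁻¹
_⁻¹ : Collineation → Collineation
φ ⁻¹ = record
  { to = from φ ; from = to φ ; to-from = from-to φ ; from-to = to-from φ ; to-third = from-third φ }

infixr 9 _⊚_
_⊚_ : Collineation → Collineation → Collineation
φ ⊚ ψ = record
  { to = to φ ∘ to ψ
  ; from = from ψ ∘ from φ
  ; to-from = λ p → trans (cong (to φ) (to-from ψ _)) (to-from φ p)
  ; from-to = λ p → trans (cong (from ψ) (from-to φ _)) (from-to ψ p)
  ; to-third = λ p q → trans (cong (to φ) (to-third ψ p q)) (to-third φ _ _)
  }

infix 4 _≈[_]_
-- `S` is the preimage of `S′` under `φ`; preimages are the natural direction because point sets are
-- Boolean functions. A record, unlike a bare pointwise equation, lets the sets and the map be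
-- recovered from the type.
record _≈[_]_ (S : PSet) (φ : Collineation) (S′ : PSet) : Set where
  constructor pullback
  field at : ∀ p → S p ≡ S′ (to φ p)

open _≈[_]_

module _ {φ : Collineation} where

  ≈-flip : ∀ {S S′} → S ≈[ φ ] S′ → S′ ≈[ φ ⁻¹ ] S
  ≈-flip {S} {S′} e .at p = sym (trans (at e (from φ p)) (cong S′ (to-from φ p)))

  to-≈ : ∀ {S} → S ∘ to φ ≈[ φ ] S
  to-≈ .at _ = refl

  from-≈ : ∀ {S} → S ≈[ φ ] S ∘ from φ
  from-≈ {S} .at p = cong S (sym (from-to φ p))

  ≈-∪ : ∀ {S S′ R R′} → S ≈[ φ ] S′ → R ≈[ φ ] R′ → S ∪ₚ R ≈[ φ ] S′ ∪ₚ R′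
  ≈-∪ e e′ .at p = cong₂ _∨_ (at e p) (at e′ p)

  ≈-≐ : ∀ {S S′ R R′} → S ≈[ φ ] S′ → R ≈[ φ ] R′ → S′ ≐ R′ → S ≐ R
  ≈-≐ e e′ eq p = trans (at e p) (trans (eq _) (sym (at e′ p)))

  to-∈ : ∀ {S S′ p} → S ≈[ φ ] S′ → p ∈ₚ S → to φ p ∈ₚ S′
  to-∈ e p∈ = trans (sym (at e _)) p∈

  cap-≈ : ∀ {S S′} → S ≈[ φ ] S′ → Cap S′ → Cap S
  cap-≈ {S} {S′} e cap = third-cap λ x y x≢y x∈ y∈ z∈ →
    cap-third cap (x≢y ∘ to-injective φ) (to-∈ e x∈) (to-∈ e y∈)
      (subst (_∈ₚ S′) (to-third φ x y) (to-∈ e z∈))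

  size-≈-≤ : ∀ {S S′} → S ≈[ φ ] S′ → size S ≤ size S′
  size-≈-≤ {S} {S′} e = size-≤ {S} {S′} (to φ) (to-injective φ) (λ p p∈ → to-∈ e p∈)

size-≈ : ∀ {φ S S′} → S ≈[ φ ] S′ → size S ≡ size S′
size-≈ e = ℕₚ.≤-antisym (size-≈-≤ e) (size-≈-≤ (≈-flip e))

module _ {φ : Collineation} where

  maxCap-≈ : ∀ {S S′} → S ≈[ φ ] S′ → MaxCap S′ → MaxCap S
  maxCap-≈ {S} e (cap , max) = cap-≈ e cap , λ T capT →
    subst₂ _≤_ (sym (size-≈ (from-≈ {φ} {T}))) (sym (size-≈ e))
      (max (T ∘ from φ) (cap-≈ (to-≈ {φ ⁻¹} {T}) capT))

  anchor-≈ : ∀ {S S′ a} → S ≈[ φ ] S′ → Anchor a S′ → Anchor (from φ a) S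
  anchor-≈ {S} {S′} {a} e (a∉ , closed) =
    (λ a∈ → a∉ (subst (_∈ₚ S′) (to-from φ a) (to-∈ e a∈))) ,
    (λ b b∈ → trans (at e _) (subst (_∈ₚ S′)
      (sym (trans (to-third φ (from φ a) b) (cong (λ q → third q (to φ b)) (to-from φ a))))
      (closed (to φ b) (to-∈ e b∈))))

  disjoint-≈ : ∀ {S S′ R R′} → S ≈[ φ ] S′ → R ≈[ φ ] R′ → Disjoint S′ R′ → Disjoint S R
  disjoint-≈ e e′ disj p p∈S p∈R = disj (to φ p) (to-∈ e p∈S) (to-∈ e′ p∈R)

  partition-≈ : ∀ {a C C′ M M′ D D′ E E′} →
    C ≈[ φ ] C′ → M ≈[ φ ] M′ → D ≈[ φ ] D′ → E ≈[ φ ] E′ →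
    Partition a C′ M′ D′ E′ → Partition (from φ a) C M D E
  partition-≈ c m d e
    ((mc , mm , md , me) , (ac , am , ad , ae) , (d₁ , d₂ , d₃ , d₄ , d₅ , d₆) , cover) =
    (maxCap-≈ c mc , maxCap-≈ m mm , maxCap-≈ d md , maxCap-≈ e me) ,
    (anchor-≈ c ac , anchor-≈ m am , anchor-≈ d ad , anchor-≈ e ae) ,
    (disjoint-≈ c m d₁ , disjoint-≈ c d d₂ , disjoint-≈ c e d₃ ,
     disjoint-≈ m d d₄ , disjoint-≈ m e d₅ , disjoint-≈ d e d₆) ,
    λ p → ⊎-map (λ eq → trans (sym (from-to φ p)) (cong (from φ) eq))
      (⊎-map (trans (at c p)) (⊎-map (trans (at m p)) (⊎-map (trans (at d p)) (trans (at e p)))))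
      (cover (to φ p))

module _ {φ : Collineation} where

  -- Existence pulls the given partition back along `φ`, whereas uniqueness pushes a rival partition
  -- forward and compares there, so this one implication needs both directions of `φ`.
  oneCompletable-≈ : ∀ {C C′ M M′} → C ≈[ φ ] C′ → M ≈[ φ ] M′ →
    OneCompletable C′ M′ → OneCompletable C M
  oneCompletable-≈ c m (a , D′ , E′ , part , uniq) =
    from φ a , D′ ∘ to φ , E′ ∘ to φ ,
    partition-≈ c m (to-≈ {φ} {D′}) (to-≈ {φ} {E′}) part ,
    λ b D E part′ →
      ⊎-map (λ (x , y) → pull D x , pull E y) (λ (x , y) → pull D x , pull E y)
        (uniq (to φ b) (D ∘ from φ) (E ∘ from φ)
          (partition-≈ (≈-flip c) (≈-flip m) (to-≈ {φ ⁻¹} {D}) (to-≈ {φ ⁻¹} {E}) part′))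
    where
    pull : ∀ S {S′} → S ∘ from φ ≐ S′ → S ≐ S′ ∘ to φ
    pull S e p = trans (cong S (sym (from-to φ p))) (e (to φ p))

  sixCompletions-≈ : ∀ {S S′ T T′ Ms} → S ≈[ φ ] S′ → T ≈[ φ ] T′ →
    SixCompletions S′ T′ Ms → SixCompletions S T (λ i → Ms i ∘ to φ)
  sixCompletions-≈ {S} {S′} {Ms = Ms} s t (first , good , distinct , complete) =
    (λ p → trans (first _) (sym (at t p))) ,
    (λ i → maxCap-≈ (≈-∪ s (to-≈ {φ} {Ms i})) (proj₁ (good i)) ,
           disjoint-≈ s (to-≈ {φ} {Ms i}) (proj₂ (good i))) ,
    (λ i j i≢j eq → distinct i j i≢j
      (≈-≐ {φ ⁻¹} (≈-flip (to-≈ {φ} {Ms i})) (≈-flip (to-≈ {φ} {Ms j})) eq)) ,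
    λ M max sub →
      let i , e = complete (M ∘ from φ) (maxCap-≈ (to-≈ {φ ⁻¹} {M}) max)
                    (λ p p∈ → sub _ (to-∈ (≈-flip s) p∈))
      in i , ≈-≐ (from-≈ {φ} {M}) (≈-∪ s (to-≈ {φ} {Ms i})) e

-- `C'` does not occur in the conclusion of the theorem, so it is a property of `C` and the two
-- demicaps, and in this form it is carried over from the standard caps.
Conclusion : PSet → PSet → PSet → Set
Conclusion C C₁ R₁ =
  Σ (Fin 6 → PSet) λ Rs → Σ (Fin 6 → PSet) λ Cs →
    SixCompletions C₁ R₁ Rs × SixCompletions R₁ C₁ Cs ×
    (∀ i j → MaxCap (Rs i ∪ₚ Cs j)) ×
    (∀ i j i′ j′ → (i , j) ≢ (i′ , j′) → ¬ (Rs i ∪ₚ Cs j ≐ Rs i′ ∪ₚ Cs j′)) ×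
    (∀ M → MaxCap M → OneCompletable C M →
       Σ (Fin 6) λ i → Σ (Fin 6) λ j → M ≐ Rs i ∪ₚ Cs j) ×
    (∀ i j → OneCompletable C (Rs i ∪ₚ Cs j))

conclusion-≈ : ∀ {φ C C′ C₁ C₁′ R₁ R₁′} →
  C ≈[ φ ] C′ → C₁ ≈[ φ ] C₁′ → R₁ ≈[ φ ] R₁′ → Conclusion C′ C₁′ R₁′ → Conclusion C C₁ R₁
conclusion-≈ {φ} {C} c c₁ r₁ (Rs , Cs , sixR , sixC , max , distinct , complete , one) =
  (λ i → Rs i ∘ to φ) , (λ j → Cs j ∘ to φ) ,
  sixCompletions-≈ c₁ r₁ sixR , sixCompletions-≈ r₁ c₁ sixC ,
  (λ i j → maxCap-≈ (union i j) (max i j)) ,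
  (λ i j i′ j′ ne eq → distinct i j i′ j′ ne
    (≈-≐ {φ ⁻¹} (≈-flip (union i j)) (≈-flip (union i′ j′)) eq)) ,
  (λ M maxM oneM →
    let i , j , e = complete (M ∘ from φ) (maxCap-≈ (to-≈ {φ ⁻¹} {M}) maxM)
                      (oneCompletable-≈ (≈-flip c) (to-≈ {φ ⁻¹} {M}) oneM)
    in i , j , ≈-≐ (from-≈ {φ} {M}) (union i j) e) ,
  (λ i j → oneCompletable-≈ c (union i j) (one i j))
  where
  union : ∀ i j → (Rs i ∘ to φ) ∪ₚ (Cs j ∘ to φ) ≈[ φ ] Rs i ∪ₚ Cs j
  union i j = ≈-∪ (to-≈ {φ} {Rs i}) (to-≈ {φ} {Cs j})

-- Linear coordinates

⊕-third : (a p q : Vec F3 n) →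
  zipWith _+₃_ (map -₃_ (zipWith _+₃_ p q)) a ≡
  map -₃_ (zipWith _+₃_ (zipWith _+₃_ p a) (zipWith _+₃_ q a))
⊕-third [] [] [] = refl
⊕-third (a ∷ as) (p ∷ ps) (q ∷ qs) = cong₂ _∷_ (coordinate a p q) (⊕-third as ps qs)
  where
  coordinate : ∀ a p q → -₃ (p +₃ q) +₃ a ≡ -₃ ((p +₃ a) +₃ (q +₃ a))
  coordinate = from-yes (all? λ a → all? λ p → all? λ q →
    -₃ (p +₃ q) +₃ a ≟F -₃ ((p +₃ a) +₃ (q +₃ a)))

⊕-⊖ : (p a : Vec F3 n) → zipWith _+₃_ (zipWith _+₃_ p (map -₃_ a)) a ≡ p
⊕-⊖ [] [] = refl
⊕-⊖ (p ∷ ps) (a ∷ as) = cong₂ _∷_ (coordinate p a) (⊕-⊖ ps as)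
  where
  coordinate : ∀ p a → (p +₃ -₃ a) +₃ a ≡ p
  coordinate = from-yes (all? λ p → all? λ a → (p +₃ -₃ a) +₃ a ≟F p)

⊖-⊕ : (p a : Vec F3 n) → zipWith _+₃_ (zipWith _+₃_ p a) (map -₃_ a) ≡ p
⊖-⊕ [] [] = refl
⊖-⊕ (p ∷ ps) (a ∷ as) = cong₂ _∷_ (coordinate p a) (⊖-⊕ ps as)
  where
  coordinate : ∀ p a → (p +₃ a) +₃ -₃ a ≡ p
  coordinate = from-yes (all? λ p → all? λ a → (p +₃ a) +₃ -₃ a ≟F p)

⊖-self : (a : Vec F3 n) → zipWith _+₃_ a (map -₃_ a) ≡ replicate n zero
⊖-self [] = refl
⊖-self (a ∷ as) = cong₂ _∷_ (coordinate a) (⊖-self as)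
  where
  coordinate : ∀ a → a +₃ -₃ a ≡ zero
  coordinate = from-yes (all? λ a → a +₃ -₃ a ≟F zero)

translation : Point → Collineation
translation a = record
  { to = _⊕ a
  ; from = _⊕ ⊖ a
  ; to-from = λ p → ⊕-⊖ p a
  ; from-to = λ p → ⊖-⊕ p a
  ; to-third = ⊕-third a
  }

-- The vectors vs are the columns of the matrix.
lin : Vec Point k → Vec F3 k → Point
lin [] [] = 0ₚ
lin (v ∷ vs) (c ∷ cs) = c · v ⊕ lin vs cs

-- Subtraction, scaling and third, applied coordinatewise, all commute with linear maps for this reason.
IsLinear₂ : (F3 → F3 → F3) → Set
IsLinear₂ g = g zero zero ≡ zero ×
  (∀ s t v x y → g s t *₃ v +₃ g x y ≡ g (s *₃ v +₃ x) (t *₃ v +₃ y))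

lin-zipWith : ∀ {g} → IsLinear₂ g → (vs : Vec Point k) (c d : Vec F3 k) →
  lin vs (zipWith g c d) ≡ zipWith g (lin vs c) (lin vs d)
lin-zipWith {g = g} (g00 , _) [] [] [] = zeros 4
  where
  zeros : ∀ n → replicate n zero ≡ zipWith g (replicate n zero) (replicate n zero)
  zeros ℕ.zero = refl
  zeros (ℕ.suc n) = cong₂ _∷_ (sym g00) (zeros n)
lin-zipWith {g = g} isLin@(_ , glin) (v ∷ vs) (s ∷ c) (t ∷ d) =
  trans (cong (g s t · v ⊕_) (lin-zipWith isLin vs c d)) (combine v (lin vs c) (lin vs d))
  where
  combine : ∀ {n} (v x y : Vec F3 n) →
    zipWith _+₃_ (map (g s t *₃_) v) (zipWith g x y) ≡
    zipWith g (zipWith _+₃_ (map (s *₃_) v) x) (zipWith _+₃_ (map (t *₃_) v) y)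
  combine [] [] [] = refl
  combine (v ∷ vs) (x ∷ xs) (y ∷ ys) = cong₂ _∷_ (glin s t v x y) (combine vs xs ys)

isLinear₂? : ∀ g → Dec (IsLinear₂ g)
isLinear₂? g = (g zero zero ≟F zero) ×-dec
  (all? λ s → all? λ t → all? λ v → all? λ x → all? λ y →
    g s t *₃ v +₃ g x y ≟F g (s *₃ v +₃ x) (t *₃ v +₃ y))

_-₂_ : F3 → F3 → F3
x -₂ y = x +₃ -₃ y

third₁ : F3 → F3 → F3
third₁ x y = -₃ (x +₃ y)

-- The dummy last argument turns scaling into a binary operation, to which `lin-zipWith` applies.
scale : F3 → F3 → F3 → F3
scale s x _ = s *₃ x

abstract
  difference-linear : IsLinear₂ _-₂_
  difference-linear = from-yes (isLinear₂? _-₂_)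

  third-linear : IsLinear₂ third₁
  third-linear = from-yes (isLinear₂? third₁)

  scale-linear : ∀ s → IsLinear₂ (scale s)
  scale-linear = from-yes (all? λ s → isLinear₂? (scale s))

map-zipWith-third : (x y : Vec F3 n) → zipWith third₁ x y ≡ map -₃_ (zipWith _+₃_ x y)
map-zipWith-third [] [] = refl
map-zipWith-third (x ∷ xs) (y ∷ ys) = cong (_ ∷_) (map-zipWith-third xs ys)

lin-third : (vs : Vec Point 4) (c d : Point) → lin vs (third c d) ≡ third (lin vs c) (lin vs d)
lin-third vs c d = begin
  lin vs (third c d)                    ≡⟨ cong (lin vs) (map-zipWith-third c d) ⟨
  lin vs (zipWith third₁ c d)           ≡⟨ lin-zipWith third-linear vs c d ⟩
  zipWith third₁ (lin vs c) (lin vs d)  ≡⟨ map-zipWith-third _ _ ⟩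
  third (lin vs c) (lin vs d)           ∎
  where open ≡-Reasoning

Independent : Vec Point k → Set
Independent vs = ∀ c → lin vs c ≡ 0ₚ → c ≡ replicate _ zero

lin-injective : (vs : Vec Point k) → Independent vs → ∀ {c d} → lin vs c ≡ lin vs d → c ≡ d
lin-injective vs indep {c} {d} eq = difference-zero c d
  (indep (zipWith _-₂_ c d) (trans (lin-zipWith difference-linear vs c d)
    (trans (cong (λ q → zipWith _-₂_ q (lin vs d)) eq) (self (lin vs d)))))
  where
  self : (x : Vec F3 n) → zipWith _-₂_ x x ≡ replicate n zero
  self [] = refl
  self (x ∷ xs) = cong₂ _∷_ (coordinate x) (self xs)
    where
    coordinate : ∀ x → x -₂ x ≡ zero
    coordinate = from-yes (all? λ x → x -₂ x ≟F zero)
  difference-zero : (x y : Vec F3 n) → zipWith _-₂_ x y ≡ replicate n zero → x ≡ y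
  difference-zero [] [] _ = refl
  difference-zero (x ∷ xs) (y ∷ ys) eq with ∷-injective eq
  ... | eq₁ , eq₂ = cong₂ _∷_ (coordinate x y eq₁) (difference-zero xs ys eq₂)
    where
    coordinate : ∀ x y → x -₂ y ≡ zero → x ≡ y
    coordinate = from-yes (all? λ x → all? λ y → (x -₂ y ≟F zero) →-dec (x ≟F y))

-- Membership in the list of all combinations makes spanning decidable and bounds a spanned set by
-- the length of that list.
Spanned : Vec Point k → Point → Set
Spanned vs p = p ∈ L.map (lin vs) (allVecs _)

spanned? : (vs : Vec Point k) → ∀ p → Dec (Spanned vs p)
spanned? vs p = DecMembership._∈?_ _≟ₚ_ p (L.map (lin vs) (allVecs _))

lin-spanned : (vs : Vec Point k) → ∀ c → Spanned vs (lin vs c)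
lin-spanned vs c = ∈-map⁺ (lin vs) (∈-allVecs c)

-- If s ≢ 0 then s v + x = 0 gives v = - s x, since s s = 1.
head-zero : ∀ {v} {vs : Vec Point k} → ¬ Spanned vs v → ∀ s c → s · v ⊕ lin vs c ≡ 0ₚ → s ≡ zero
head-zero _ zero _ _ = refl
head-zero {v = v} {vs} v∉ s@(suc _) c eq = contradiction
  (subst (Spanned vs)
    (sym (trans (solve s (λ ()) v (lin vs c) eq) (sym (lin-zipWith (scale-linear (-₃ s)) vs c c))))
    (lin-spanned vs (zipWith (scale (-₃ s)) c c)))
  v∉
  where
  coordinate : ∀ s v x → s ≢ zero → s *₃ v +₃ x ≡ zero → v ≡ scale (-₃ s) x x
  coordinate = from-yes (all? λ s → all? λ v → all? λ x →
    ¬? (s ≟F zero) →-dec ((s *₃ v +₃ x ≟F zero) →-dec (v ≟F scale (-₃ s) x x)))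
  solve : ∀ s → s ≢ zero → (v x : Vec F3 n) → zipWith _+₃_ (map (s *₃_) v) x ≡ replicate n zero →
    v ≡ zipWith (scale (-₃ s)) x x
  solve s s≢0 [] [] _ = refl
  solve s s≢0 (v ∷ vs) (x ∷ xs) eq with ∷-injective eq
  ... | eq₁ , eq₂ = cong₂ _∷_ (coordinate s v x s≢0 eq₁) (solve s s≢0 vs xs eq₂)

0·-⊕ : (v x : Vec F3 n) → zipWith _+₃_ (map (zero *₃_) v) x ≡ x
0·-⊕ [] [] = refl
0·-⊕ (v ∷ vs) (x ∷ xs) = cong (x ∷_) (0·-⊕ vs xs)

independent-∷ : ∀ {v} {vs : Vec Point k} → Independent vs → ¬ Spanned vs v → Independent (v ∷ vs)
independent-∷ {v = v} {vs} indep v∉ (s ∷ c) eq with head-zero {vs = vs} v∉ s c eq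
... | refl = cong (zero ∷_) (indep c (trans (sym (0·-⊕ v (lin vs c))) eq))

abstract
  -- A missed value put in front of the list of all values would give a list without repetitions
  -- that is longer than the list of all elements. This supplies the inverse of a matrix without
  -- matrix algebra.
  injective⇒surjective : ∀ {xs : List A} → DecidableEquality A → Unique xs → (∀ x → x ∈ xs) →
    (f : A → A) → (∀ {x y} → f x ≡ f y → x ≡ y) → ∀ y → ∃ λ x → y ≡ f x
  injective⇒surjective {xs = xs} _≟_ uniq complete f inj y
    with DecMembership._∈?_ _≟_ y (L.map f xs)
  ... | yes y∈ = let x , _ , eq = ∈-map⁻ f {xs = xs} y∈ in x , eq
  ... | no y∉ = contradiction
    (subst (λ m → ℕ.suc m ≤ length xs) (Lₚ.length-map f xs)
      (unique-⊆⇒length≤ {xs = y ∷ L.map f xs}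
        (All.tabulate (λ z∈ eq → y∉ (subst (_∈ L.map f xs) (sym eq) z∈)) ∷ Uniqueₚ.map⁺ inj uniq)
        (λ _ → complete _)))
    ℕₚ.1+n≰n

linear : (vs : Vec Point 4) → Independent vs → Collineation
linear vs indep = record
  { to = lin vs
  ; from = proj₁ ∘ preimage
  ; to-from = λ p → sym (proj₂ (preimage p))
  ; from-to = λ c → lin-injective vs indep (sym (proj₂ (preimage (lin vs c))))
  ; to-third = lin-third vs
  }
  where
  preimage : ∀ p → ∃ λ c → p ≡ lin vs c
  preimage = injective⇒surjective _≟ₚ_ allPoints-unique ∈-allVecs (lin vs) (lin-injective vs indep)

size≤span : (S : PSet) (vs : Vec Point k) → (∀ p → p ∈ₚ S → Spanned vs p) →
  size S ≤ length (allVecs k)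
size≤span {k} S vs sub = subst (size S ≤_) (Lₚ.length-map (lin vs) (allVecs k))
  (unique-⊆⇒length≤ {xs = filterᵇ S allPoints} {ys = L.map (lin vs) (allVecs k)}
    (Uniqueₚ.filter⁺ (T? ∘ S) allPoints-unique)
    (λ p∈ → sub _ (proj₂ (∈-filterᵇ⁻ S allPoints p∈))))

spanned-or-new : (S : PSet) (vs : Vec Point k) →
  (∃ λ v → v ∈ₚ S × ¬ Spanned vs v) ⊎ (∀ p → p ∈ₚ S → Spanned vs p)
spanned-or-new S vs
  with Any.any? (λ v → (S v Bool.≟ true) ×-dec ¬? (spanned? vs v)) allPoints
... | yes found = inj₁ (Any.satisfied found)
... | no none = inj₂ λ p p∈ → spanned p p∈ (spanned? vs p)
  where
  spanned : ∀ p → p ∈ₚ S → Dec (Spanned vs p) → Spanned vs p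
  spanned p p∈ (yes p∈span) = p∈span
  spanned p p∈ (no p∉span) =
    contradiction (Any.map (λ { refl → p∈ , p∉span }) (∈-allVecs p)) none

new-vector : (S : PSet) (vs : Vec Point k) → length (allVecs k) < size S →
  ∃ λ v → v ∈ₚ S × ¬ Spanned vs v
new-vector S vs big with spanned-or-new S vs
... | inj₁ new = new
... | inj₂ sub = contradiction (size≤span S vs sub) (ℕₚ.<⇒≱ big)

-- Exhaustive search for caps

-- Plain Boolean tests keep proof terms out of the large searches; soundness is proved once,
-- afterwards.
≡ᵇ₃ : F3 → F3 → Bool
≡ᵇ₃ zero zero = true
≡ᵇ₃ (suc zero) (suc zero) = true
≡ᵇ₃ (suc (suc zero)) (suc (suc zero)) = true
≡ᵇ₃ _ _ = false

infix 4 _==_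
_==_ : Vec F3 n → Vec F3 n → Bool
[] == [] = true
(x ∷ xs) == (y ∷ ys) = ≡ᵇ₃ x y ∧ (xs == ys)

==⇒≡ : (x y : Vec F3 n) → (x == y) ≡ true → x ≡ y
==⇒≡ [] [] _ = refl
==⇒≡ (zero ∷ xs) (zero ∷ ys) eq = cong (_ ∷_) (==⇒≡ xs ys eq)
==⇒≡ (suc zero ∷ xs) (suc zero ∷ ys) eq = cong (_ ∷_) (==⇒≡ xs ys eq)
==⇒≡ (suc (suc zero) ∷ xs) (suc (suc zero) ∷ ys) eq = cong (_ ∷_) (==⇒≡ xs ys eq)

==-refl : (x : Vec F3 n) → (x == x) ≡ true
==-refl [] = refl
==-refl (zero ∷ xs) = ==-refl xs
==-refl (suc zero ∷ xs) = ==-refl xs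
==-refl (suc (suc zero) ∷ xs) = ==-refl xs

mem : Point → List Point → Bool
mem x [] = false
mem x (y ∷ ys) = if x == y then true else mem x ys

mem⇒∈ : ∀ {x} ys → mem x ys ≡ true → x ∈ ys
mem⇒∈ {x} (y ∷ ys) eq with x == y in x=y
... | true = here (==⇒≡ x y x=y)
... | false = there (mem⇒∈ ys eq)

∈⇒mem : ∀ {x ys} → x ∈ ys → mem x ys ≡ true
∈⇒mem {x} (here refl) rewrite ==-refl x = refl
∈⇒mem {x} {y ∷ ys} (there x∈) with x == y
... | true = refl
... | false = ∈⇒mem x∈

∧-true : ∀ {b c} → b ∧ c ≡ true → b ≡ true × c ≡ true
∧-true {true} {true} _ = refl , refl

∨-true : ∀ {b c} → b ∨ c ≡ true → b ≡ true ⊎ c ≡ true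
∨-true {true} _ = inj₁ refl
∨-true {false} eq = inj₂ eq

not-true : ∀ {b} → not b ≡ true → b ≡ false
not-true {false} _ = refl

true≢false : ∀ {b} → b ≡ true → b ≢ false
true≢false refl ()

¬true⇒false : ∀ {b} → b ≢ true → b ≡ false
¬true⇒false {true} ne = contradiction refl ne
¬true⇒false {false} _ = refl

bool-ext : ∀ {b c} → (b ≡ true → c ≡ true) → (c ≡ true → b ≡ true) → b ≡ c
bool-ext {true} f g = sym (f refl)
bool-ext {false} {true} f g = g refl
bool-ext {false} {false} f g = refl

all-∈ : ∀ (P : A → Bool) {x xs} → all P xs ≡ true → x ∈ xs → P x ≡ true
all-∈ P {xs = _ ∷ _} eq (here refl) = proj₁ (∧-true eq)
all-∈ P {xs = _ ∷ _} eq (there x∈) = all-∈ P (proj₂ (∧-true eq)) x∈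

any-∃ : ∀ (P : A → Bool) xs → any P xs ≡ true → ∃ λ x → x ∈ xs × P x ≡ true
any-∃ P (x ∷ xs) eq with ∨-true {P x} eq
... | inj₁ Px = x , here refl , Px
... | inj₂ rest = let y , y∈ , Py = any-∃ P xs rest in y , there y∈ , Py

count : (A → Bool) → List A → ℕ
count P xs = length (filterᵇ P xs)

count-⊎ : ∀ {S P Q : A → Bool} → (∀ x → S x ≡ P x ∨ Q x) →
  (∀ x → P x ≡ true → Q x ≢ true) → ∀ xs → count S xs ≡ count P xs + count Q xs
count-⊎ union disj [] = refl
count-⊎ {S = S} {P} {Q} union disj (x ∷ xs)
  with S x | P x in p | Q x in q | union x
... | true | true | true | _ = contradiction q (disj x p)
... | true | true | false | _ = cong ℕ.suc (count-⊎ union disj xs)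
... | true | false | true | _ =
  trans (cong ℕ.suc (count-⊎ union disj xs)) (sym (ℕₚ.+-suc _ _))
... | false | false | false | _ = count-⊎ union disj xs

count-cong : ∀ {S P : A → Bool} → (∀ x → S x ≡ P x) → ∀ xs → count S xs ≡ count P xs
count-cong eq [] = refl
count-cong {S = S} {P} eq (x ∷ xs) with S x | P x | eq x
... | true | true | _ = cong ℕ.suc (count-cong eq xs)
... | false | false | _ = count-cong eq xs

count-all : ∀ (S : A → Bool) {xs} → All (λ x → S x ≡ true) xs → count S xs ≡ length xs
count-all S [] = refl
count-all S (Sx ∷ Sxs) rewrite Sx = cong ℕ.suc (count-all S Sxs)

count-filterᵇ : ∀ (S P : A → Bool) xs → count S (filterᵇ P xs) ≡ count (λ x → S x ∧ P x) xs
count-filterᵇ S P [] = refl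
count-filterᵇ S P (x ∷ xs) with P x | S x in s
... | true | true rewrite s = cong ℕ.suc (count-filterᵇ S P xs)
... | true | false rewrite s = count-filterᵇ S P xs
... | false | true = count-filterᵇ S P xs
... | false | false = count-filterᵇ S P xs

count-superset : ∀ (S P : A → Bool) xs → (∀ x → S x ≡ true → P x ≡ true) →
  count S (filterᵇ P xs) ≡ count S xs
count-superset S P xs sub = trans (count-filterᵇ S P xs) (count-cong absorb xs)
  where
  absorb : ∀ x → S x ∧ P x ≡ S x
  absorb x = bool-ext (proj₁ ∘ ∧-true) (λ Sx → cong₂ _∧_ Sx (sub x Sx))

count-split : ∀ (S P : A → Bool) xs →
  count S xs ≡ count S (filterᵇ P xs) + count S (filterᵇ (not ∘ P) xs)
count-split S P xs = trans (count-⊎ union disj xs)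
  (cong₂ _+_ (sym (count-filterᵇ S P xs)) (sym (count-filterᵇ S (not ∘ P) xs)))
  where
  union : ∀ x → S x ≡ (S x ∧ P x) ∨ (S x ∧ not (P x))
  union x with S x | P x
  ... | true | true = refl
  ... | true | false = refl
  ... | false | _ = refl
  disj : ∀ x → S x ∧ P x ≡ true → S x ∧ not (P x) ≢ true
  disj x eq eq′ = true≢false (proj₂ (∧-true eq)) (not-true (proj₂ (∧-true {S x} eq′)))

count≤length : ∀ (S : A → Bool) xs → count S xs ≤ length xs
count≤length S xs = Lₚ.length-filter (T? ∘ S) xs

∈⇒count : ∀ (S : A → Bool) {x xs} → x ∈ xs → S x ≡ true → count S xs ≢ 0
∈⇒count S {xs = xs} x∈ Sx eq with filterᵇ S xs | ∈-filterᵇ⁺ S x∈ Sx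
∈⇒count S x∈ Sx () | _ ∷ _ | _

-- `block x c` lists points that a set containing `x` and `c` must avoid. Leaving it open lets one
-- search serve both projective and affine caps.
module Search (block : Point → Point → List Point) where

  blocks : Point → List Point → List Point
  blocks x [] = []
  blocks x (c ∷ cs) = block x c ++ blocks x cs

  pairBlocks : List Point → List Point
  pairBlocks [] = []
  pairBlocks (x ∷ xs) = blocks x xs ++ pairBlocks xs

  sieve : List Point → List Point → List Point
  sieve bl = filterᵇ (λ y → not (mem y bl))

  -- Extends ch by k points of av. The sieved list is not structurally smaller, so the
  -- recursion is on a bound for the length of av.
  search : (fuel k : ℕ) → List Point → List Point → List (List Point)
  search _ 0 ch av = ch ∷ []
  search 0 (ℕ.suc k) ch av = []
  search (ℕ.suc f) (ℕ.suc k) ch [] = []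
  search (ℕ.suc f) (ℕ.suc k) ch (x ∷ av) =
    -- In this case `x` and `av` together have fewer than the `k + 1` points still needed.
    if length av <ᵇ k then []
    else search f k (x ∷ ch) (sieve (blocks x ch) av) ++ search f (ℕ.suc k) ch av

  -- The k-subsets of av that contain ch but no blocked triple; opaque, because comparing types
  -- mentioning them would otherwise run the search.
  opaque
    extensions : ℕ → List Point → List Point → List (List Point)
    extensions k ch av = search (length av) (k ∸ length (filterᵇ (λ x → mem x ch) av)) ch
      (sieve (pairBlocks ch) (sieve ch av))

  module _ (S : PSet) (block-∉ : ∀ x c → S x ≡ true → S c ≡ true → All (λ y → S y ≢ true) (block x c))
    where

    -- The list found need only lie in `S` and cover what `S` has in `ch` and `av`. Order and
    -- repetitions do not matter; if `ch` and `av` exhaust `S`, the list determines `S`.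
    Captures : List Point → List Point → List Point → Set
    Captures ch av r =
      All (λ x → S x ≡ true) r × (∀ x → S x ≡ true → x ∈ ch ⊎ x ∈ av → x ∈ r)

    blocks-∉ : ∀ x {ch} → S x ≡ true → All (λ c → S c ≡ true) ch → All (λ y → S y ≢ true) (blocks x ch)
    blocks-∉ x Sx [] = []
    blocks-∉ x Sx (Sc ∷ Sch) = Allₚ.++⁺ (block-∉ x _ Sx Sc) (blocks-∉ x Sx Sch)

    pairBlocks-∉ : ∀ {ch} → All (λ c → S c ≡ true) ch → All (λ y → S y ≢ true) (pairBlocks ch)
    pairBlocks-∉ [] = []
    pairBlocks-∉ (Sc ∷ Sch) = Allₚ.++⁺ (blocks-∉ _ Sc Sch) (pairBlocks-∉ Sch)

    survives : ∀ {bl} → All (λ y → S y ≢ true) bl → ∀ x → S x ≡ true → not (mem x bl) ≡ true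
    survives {bl} ∉bl x Sx with mem x bl in eq
    ... | true = contradiction Sx (All.lookup ∉bl (mem⇒∈ bl eq))
    ... | false = refl

    -- Follow the branch that `S` itself prescribes: take `x` exactly if it lies in `S`. The sieve
    -- discards only points outside `S`, so the count of points still to be found stays correct.
    search-complete : ∀ f k {ch av} → All (λ c → S c ≡ true) ch → length av ≤ f →
      count S av ≡ k → Any (Captures ch av) (search f k ch av)
    search-complete f 0 Sch _ none = here (Sch , λ x Sx →
      [ id , (λ x∈av → contradiction none (∈⇒count S x∈av Sx)) ]′)
    search-complete (ℕ.suc f) (ℕ.suc k) {ch} {x ∷ av} Sch (s≤s len) cnt
      with length av <ᵇ k in short | S x in Sx
    ... | true | true = contradiction
      (subst (_≤ length av) (ℕₚ.suc-injective cnt) (count≤length S av))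
      (ℕₚ.<⇒≱ (ℕₚ.<ᵇ⇒< _ _ (≡⇒T short)))
    ... | true | false = contradiction
      (ℕₚ.<⇒≤ (subst (_≤ length av) cnt (count≤length S av)))
      (ℕₚ.<⇒≱ (ℕₚ.<ᵇ⇒< _ _ (≡⇒T short)))
    ... | false | true = Anyₚ.++⁺ˡ (Any.map widen
      (search-complete f k (Sx ∷ Sch)
        (ℕₚ.≤-trans (Lₚ.length-filter (T? ∘ (λ y → not (mem y (blocks x ch)))) av) len)
        (trans (count-superset S _ av survive) (ℕₚ.suc-injective cnt))))
      where
      survive : ∀ y → S y ≡ true → not (mem y (blocks x ch)) ≡ true
      survive = survives (blocks-∉ x Sx Sch)
      widen : ∀ {r} → Captures (x ∷ ch) (sieve (blocks x ch) av) r → Captures ch (x ∷ av) r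
      widen (Sr , cover) = Sr , λ y Sy → cover y Sy ∘ λ
        { (inj₁ y∈ch) → inj₁ (there y∈ch)
        ; (inj₂ (here refl)) → inj₁ (here refl)
        ; (inj₂ (there y∈av)) → inj₂ (∈-filterᵇ⁺ _ y∈av (survive y Sy)) }
    ... | false | false = Anyₚ.++⁺ʳ (search f k (x ∷ ch) (sieve (blocks x ch) av))
      (Any.map widen (search-complete f (ℕ.suc k) Sch len cnt))
      where
      widen : ∀ {r} → Captures ch av r → Captures ch (x ∷ av) r
      widen (Sr , cover) = Sr , λ y Sy → cover y Sy ∘ λ
        { (inj₁ y∈ch) → inj₁ y∈ch
        ; (inj₂ (here refl)) → contradiction Sx (true≢false Sy)
        ; (inj₂ (there y∈av)) → inj₂ y∈av }

    opaque
      unfolding extensions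
      extensions-complete : ∀ k ch av → All (λ c → S c ≡ true) ch → count S av ≡ k →
        Any (Captures ch av) (extensions k ch av)
      extensions-complete k ch av Sch cnt = Any.map widen
        (search-complete (length av) (k ∸ length seeds) Sch
          (ℕₚ.≤-trans (Lₚ.length-filter (T? ∘ _) (sieve ch av)) (Lₚ.length-filter (T? ∘ _) av))
          remaining)
        where
        seeds : List Point
        seeds = filterᵇ (λ x → mem x ch) av
        seeds-∈ : All (λ x → S x ≡ true) seeds
        seeds-∈ = All.tabulate λ x∈ → All.lookup Sch (mem⇒∈ ch (proj₂ (∈-filterᵇ⁻ _ av x∈)))
        -- Removing `ch` costs exactly the seeds, all of which lie in `S`; removing the blocked
        -- points costs `S` nothing.
        remaining : count S (sieve (pairBlocks ch) (sieve ch av)) ≡ k ∸ length seeds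
        remaining = begin
          count S (sieve (pairBlocks ch) (sieve ch av))
            ≡⟨ count-superset S _ (sieve ch av) (survives (pairBlocks-∉ Sch)) ⟩
          count S (sieve ch av)
            ≡⟨ ℕₚ.m+n∸m≡n (length seeds) _ ⟨
          (length seeds + count S (sieve ch av)) ∸ length seeds
            ≡⟨ cong (λ m → m + count S (sieve ch av) ∸ length seeds) (count-all S seeds-∈) ⟨
          (count S seeds + count S (sieve ch av)) ∸ length seeds
            ≡⟨ cong (_∸ length seeds) (trans (sym (count-split S (λ x → mem x ch) av)) cnt) ⟩
          k ∸ length seeds ∎
          where open ≡-Reasoning
        widen : ∀ {r} → Captures ch (sieve (pairBlocks ch) (sieve ch av)) r → Captures ch av r
        widen (Sr , cover) = Sr , λ x Sx → cover x Sx ∘ λ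
          { (inj₁ x∈ch) → inj₁ x∈ch
          ; (inj₂ x∈av) → place x Sx x∈av }
          where
          place : ∀ x → S x ≡ true → x ∈ av → x ∈ ch ⊎ x ∈ sieve (pairBlocks ch) (sieve ch av)
          place x Sx x∈av with mem x ch in eq
          ... | true = inj₁ (mem⇒∈ ch eq)
          ... | false = inj₂ (∈-filterᵇ⁺ _ (∈-filterᵇ⁺ _ x∈av (cong not eq))
            (survives (pairBlocks-∉ Sch) x Sx))

-- Symmetric sets as sets of points of PG(3,3)

⊖-involutive : (x : Vec F3 n) → map -₃_ (map -₃_ x) ≡ x
⊖-involutive [] = refl
⊖-involutive (zero ∷ xs) = cong (_ ∷_) (⊖-involutive xs)
⊖-involutive (suc zero ∷ xs) = cong (_ ∷_) (⊖-involutive xs)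
⊖-involutive (suc (suc zero) ∷ xs) = cong (_ ∷_) (⊖-involutive xs)

third-origin : ∀ b → third 0ₚ b ≡ ⊖ b
third-origin (_ ∷ _ ∷ _ ∷ _ ∷ []) = refl

⊖-third : (x y : Vec F3 n) → map -₃_ (map -₃_ (zipWith _+₃_ x y)) ≡
  map -₃_ (zipWith _+₃_ (map -₃_ x) (map -₃_ y))
⊖-third [] [] = refl
⊖-third (x ∷ xs) (y ∷ ys) = cong₂ _∷_ (cong -₃_ (coordinate x y)) (⊖-third xs ys)
  where
  coordinate : ∀ x y → -₃ (x +₃ y) ≡ -₃ x +₃ -₃ y
  coordinate zero y = refl
  coordinate (suc zero) zero = refl
  coordinate (suc zero) (suc zero) = refl
  coordinate (suc zero) (suc (suc zero)) = refl
  coordinate (suc (suc zero)) zero = refl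
  coordinate (suc (suc zero)) (suc zero) = refl
  coordinate (suc (suc zero)) (suc (suc zero)) = refl

negation : Collineation
negation = record
  { to = ⊖_ ; from = ⊖_ ; to-from = ⊖-involutive ; from-to = ⊖-involutive ; to-third = ⊖-third }

-- The vectors with leading coefficient 1 represent the points of PG(3,3).
lead : Vec F3 n → F3
lead [] = zero
lead (zero ∷ xs) = lead xs
lead (suc s ∷ xs) = suc s

isRep : Point → Bool
isRep p = ≡ᵇ₃ (lead p) (suc zero)

norm : Point → Point
norm p with lead p
... | suc (suc zero) = ⊖ p
... | _ = p

reps : List Point
reps = filterᵇ isRep allPoints

-- Looking up `norm p` makes the set closed under negation by construction. It contains the origin
-- only if `xs` does.
antipodal : List Point → PSet
antipodal xs p = mem (norm p) xs

lead-⊖ : (x : Vec F3 n) → lead (map -₃_ x) ≡ -₃ lead x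
lead-⊖ [] = refl
lead-⊖ (zero ∷ xs) = lead-⊖ xs
lead-⊖ (suc zero ∷ xs) = refl
lead-⊖ (suc (suc zero) ∷ xs) = refl

lead-zero : (x : Vec F3 n) → lead x ≡ zero → x ≡ replicate n zero
lead-zero [] _ = refl
lead-zero (zero ∷ xs) eq = cong (zero ∷_) (lead-zero xs eq)

norm-cases : ∀ p → norm p ≡ p ⊎ norm p ≡ ⊖ p
norm-cases p with lead p
... | zero = inj₁ refl
... | suc zero = inj₁ refl
... | suc (suc zero) = inj₂ refl

norm-⊖ : ∀ p → norm (⊖ p) ≡ norm p
norm-⊖ p with lead p in eq | lead (⊖ p) | lead-⊖ p
... | zero | _ | refl rewrite lead-zero p eq = refl
... | suc zero | _ | refl = ⊖-involutive p
... | suc (suc zero) | _ | refl = refl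

isRep-⊖ : ∀ p → p ≢ 0ₚ → isRep (⊖ p) ≡ not (isRep p)
isRep-⊖ p p≢0 with lead p in eq | lead (⊖ p) | lead-⊖ p
... | zero | _ | refl = contradiction (lead-zero p eq) p≢0
... | suc zero | _ | refl = refl
... | suc (suc zero) | _ | refl = refl

norm-isRep : ∀ p → p ≢ 0ₚ → isRep (norm p) ≡ true
norm-isRep p p≢0 with lead p in eq
... | zero = contradiction (lead-zero p eq) p≢0
... | suc zero rewrite eq = refl
... | suc (suc zero) rewrite lead-⊖ p | eq = refl

module _ {S : PSet} (anchor : Anchor 0ₚ S) where

  ⊖-∈ : ∀ {p} → p ∈ₚ S → ⊖ p ∈ₚ S
  ⊖-∈ {p} p∈ = subst (_∈ₚ S) (third-origin p) (proj₂ anchor p p∈)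

  ∈⇒≢0 : ∀ {p} → p ∈ₚ S → p ≢ 0ₚ
  ∈⇒≢0 p∈ refl = proj₁ anchor p∈

  norm-∈ : ∀ p → S (norm p) ≡ S p
  norm-∈ p with norm-cases p
  ... | inj₁ eq = cong S eq
  ... | inj₂ eq = trans (cong S eq)
    (bool-ext (λ ⊖p∈ → subst (_∈ₚ S) (⊖-involutive p) (⊖-∈ ⊖p∈)) ⊖-∈)

  ∈-reps : ∀ {p} → p ∈ₚ S → norm p ∈ reps
  ∈-reps {p} p∈ = ∈-filterᵇ⁺ isRep (∈-allVecs (norm p)) (norm-isRep p (∈⇒≢0 p∈))

  -- Negation exchanges the members with leading coefficient 1 and those with leading coefficient 2,
  -- so the representatives are exactly half.
  count-reps : ∀ {m} → size S ≡ m + m → count S reps ≡ m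
  count-reps {m} eq = trans (count-filterᵇ S isRep allPoints) (half (trans (sym halves) eq))
    where
    half : ∀ {a b} → a + a ≡ b + b → a ≡ b
    half {a} {b} e with ℕₚ.<-cmp a b
    ... | tri< a<b _ _ = contradiction e (ℕₚ.<⇒≢ (ℕₚ.+-mono-< a<b a<b))
    ... | tri≈ _ a≡b _ = a≡b
    ... | tri> _ _ b<a = contradiction (sym e) (ℕₚ.<⇒≢ (ℕₚ.+-mono-< b<a b<a))
    positive negative : PSet
    positive p = S p ∧ isRep p
    negative p = S p ∧ not (isRep p)
    mirror : negative ≈[ negation ] positive
    mirror ._≈[_]_.at p with S p in Sp | S (⊖ p) in S⊖p
    ... | true | true = sym (isRep-⊖ p (∈⇒≢0 Sp))
    ... | true | false = contradiction S⊖p (true≢false (⊖-∈ Sp))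
    ... | false | true =
      contradiction Sp (true≢false (subst (_∈ₚ S) (⊖-involutive p) (⊖-∈ S⊖p)))
    ... | false | false = refl
    union : ∀ p → S p ≡ positive p ∨ negative p
    union p with S p | isRep p
    ... | true | true = refl
    ... | true | false = refl
    ... | false | _ = refl
    disj : ∀ p → positive p ≡ true → negative p ≢ true
    disj p pos neg =
      true≢false (proj₂ (∧-true {S p} pos)) (not-true (proj₂ (∧-true {S p} neg)))
    halves : size S ≡ size positive + size positive
    halves = trans (count-⊎ union disj allPoints) (cong (size positive +_) (size-≈ mirror))

  module _ {X r : List Point} (inX : ∀ {p} → p ∈ reps → p ∈ₚ S → p ∈ X)
           (captured : All (_∈ₚ S) r × (∀ p → p ∈ₚ S → p ∈ [] ⊎ p ∈ X → p ∈ r)) where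

    captured⇒antipodal : S ≐ antipodal r
    captured⇒antipodal p = trans (sym (norm-∈ p)) (bool-ext
      (λ np∈ → ∈⇒mem (proj₂ captured (norm p) np∈
        (inj₂ (inX (∈-reps (trans (sym (norm-∈ p)) np∈)) np∈))))
      (λ eq → All.lookup (proj₁ captured) (mem⇒∈ r eq)))

-- The two other points of the line through x and c in PG(3,3).
projectiveBlock : Point → Point → List Point
projectiveBlock x c =
  if (x == c) ∨ (x == ⊖ c) then [] else norm (x ⊕ c) ∷ norm (x ⊕ ⊖ c) ∷ []

affineBlock : Point → Point → List Point
affineBlock x c = if x == c then [] else third x c ∷ []

==-false⇒≢ : ∀ {x y : Point} → (x == y) ≡ false → x ≢ y
==-false⇒≢ {x} eq refl = true≢false (==-refl x) eq

affineBlock-∉ : ∀ {S} → Cap S → ∀ x c → x ∈ₚ S → c ∈ₚ S → All (_∉ₚ S) (affineBlock x c)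
affineBlock-∉ cap x c x∈ c∈ with x == c in eq
... | true = []
... | false = cap-third cap (==-false⇒≢ eq) x∈ c∈ ∷ []

-- The point `x ⊕ d` is the negative of `third x d`, so a symmetric cap omits it. Taking `c` and
-- `⊖ c` for `d` gives both remaining points of the projective line.
projectiveBlock-∉ : ∀ {S} → Cap S → Anchor 0ₚ S →
  ∀ x c → x ∈ₚ S → c ∈ₚ S → All (_∉ₚ S) (projectiveBlock x c)
projectiveBlock-∉ {S} cap anchor x c x∈ c∈ with x == c in eq | x == ⊖ c in eq′
... | true | _ = []
... | false | true = []
... | false | false =
  sum-∉ c∈ (==-false⇒≢ eq) ∷ sum-∉ (⊖-∈ anchor c∈) (==-false⇒≢ eq′) ∷ []
  where
  sum-∉ : ∀ {d} → d ∈ₚ S → x ≢ d → norm (x ⊕ d) ∉ₚ S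
  sum-∉ {d} d∈ x≢d s∈ = cap-third cap x≢d x∈ d∈
    (⊖-∈ anchor (trans (sym (norm-∈ anchor (x ⊕ d))) s∈))

module Projective = Search projectiveBlock
module Affine = Search affineBlock

standardBasis : List Point
standardBasis =
  (suc zero ∷ zero ∷ zero ∷ zero ∷ []) ∷ (zero ∷ suc zero ∷ zero ∷ zero ∷ []) ∷
  (zero ∷ zero ∷ suc zero ∷ zero ∷ []) ∷ (zero ∷ zero ∷ zero ∷ suc zero ∷ []) ∷ []

headIsZero : Point → Bool
headIsZero (x ∷ _) = ≡ᵇ₃ x zero

opaque
  unfolding Projective.extensions
  -- The 13 representatives with first coordinate zero form a projective plane, and no ten points of
  -- it are without three on a line.
  no-planar-caps : Projective.extensions 10 [] (filterᵇ headIsZero reps) ≡ []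
  no-planar-caps = refl

lin-skip : ∀ {k} v (vs : Vec Point k) c → lin (v ∷ vs) (zero ∷ c) ≡ lin vs c
lin-skip v vs c = 0·-⊕ v (lin vs c)

lin-zero : ∀ {k} (vs : Vec Point k) → lin vs (replicate k zero) ≡ 0ₚ
lin-zero [] = refl
lin-zero (v ∷ vs) = trans (lin-skip v vs _) (lin-zero vs)

lin-one : ∀ {k} v (vs : Vec Point k) → lin (v ∷ vs) (suc zero ∷ replicate k zero) ≡ v
lin-one v vs = trans (cong (suc zero · v ⊕_) (lin-zero vs)) (unit v)
  where
  +-identityʳ : ∀ x → x +₃ zero ≡ x
  +-identityʳ zero = refl
  +-identityʳ (suc zero) = refl
  +-identityʳ (suc (suc zero)) = refl
  unit : (v : Vec F3 n) → zipWith _+₃_ (map (suc zero *₃_) v) (replicate n zero) ≡ v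
  unit [] = refl
  unit (x ∷ xs) = cong₂ _∷_ (+-identityʳ x) (unit xs)

-- Phrased with `from`, since `anchor-≈` carries an anchor `a` to `from φ a`.
FixesOrigin : Collineation → Set
FixesOrigin φ = from φ 0ₚ ≡ 0ₚ

fixesOrigin : ∀ φ → to φ 0ₚ ≡ 0ₚ → FixesOrigin φ
fixesOrigin φ eq = trans (cong (from φ) (sym eq)) (from-to φ 0ₚ)

linear-fixes-origin : ∀ vs indep → FixesOrigin (linear vs indep)
linear-fixes-origin vs indep = fixesOrigin (linear vs indep) (lin-zero vs)

anchor-origin : ∀ {φ S S′} → FixesOrigin φ → S ≈[ φ ] S′ → Anchor 0ₚ S′ → Anchor 0ₚ S
anchor-origin {S = S} fix e anchor = subst (λ a → Anchor a S) fix (anchor-≈ e anchor)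

no-planar-ovoid : ∀ {S} → Cap S → Anchor 0ₚ S → size S ≡ 20 → ¬ (∀ p → p ∈ₚ S → headIsZero p ≡ true)
no-planar-ovoid {S} cap anchor size20 planar = ¬Any-[] no-planar-caps
  (Projective.extensions-complete S (projectiveBlock-∉ cap anchor) 10 [] (filterᵇ headIsZero reps) []
    (trans (count-superset S headIsZero reps planar) (count-reps anchor size20)))
  where
  ¬Any-[] : ∀ {A : Set} {P : A → Set} {xs} → xs ≡ [] → ¬ Any P xs
  ¬Any-[] refl ()

-- Spans of at most two vectors have at most 9 points, so counting against 20 gives three
-- independent vectors in `S`. It cannot give the fourth, since a span of three has 27 points; there
-- the nonexistence of planar ovoids decides.
frame : ∀ {S} → Cap S → Anchor 0ₚ S → size S ≡ 20 →
  ∃ λ φ → FixesOrigin φ × All (λ e → to φ e ∈ₚ S) standardBasis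
frame {S} cap anchor size20 =
  extend (new-vector S [] (big 1 _))
  where
  big : ∀ m → T (m <ᵇ 20) → m < size S
  big m lt = subst (m <_) (sym size20) (ℕₚ.<ᵇ⇒< m 20 lt)
  Frame : Set
  Frame = ∃ λ φ → FixesOrigin φ × All (λ e → to φ e ∈ₚ S) standardBasis
  module _ {u v w : Point} (u∈ : u ∈ₚ S) (v∈ : v ∈ₚ S) (w∈ : w ∈ₚ S)
           (indep : Independent (w ∷ v ∷ u ∷ [])) where
    vs : Vec Point 3
    vs = w ∷ v ∷ u ∷ []
    spatial : ∀ x → x ∈ₚ S → ¬ Spanned vs x → Frame
    spatial x x∈ x∉ = linear (x ∷ vs) ind , linear-fixes-origin (x ∷ vs) ind ,
      ∈S (lin-one x vs) x∈ ∷
      ∈S (trans (lin-skip x vs (suc zero ∷ zero ∷ zero ∷ [])) (lin-one w (v ∷ u ∷ []))) w∈ ∷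
      ∈S (trans (lin-skip x vs (zero ∷ suc zero ∷ zero ∷ []))
        (trans (lin-skip w (v ∷ u ∷ []) (suc zero ∷ zero ∷ [])) (lin-one v (u ∷ [])))) v∈ ∷
      ∈S (trans (lin-skip x vs (zero ∷ zero ∷ suc zero ∷ []))
        (trans (lin-skip w (v ∷ u ∷ []) (zero ∷ suc zero ∷ []))
          (trans (lin-skip v (u ∷ []) (suc zero ∷ [])) (lin-one u [])))) u∈ ∷ []
      where
      ind : Independent (x ∷ vs)
      ind = independent-∷ {vs = vs} indep x∉
      ∈S : ∀ {p q} → p ≡ q → q ∈ₚ S → p ∈ₚ S
      ∈S refl q∈ = q∈
    planar : (∀ p → p ∈ₚ S → Spanned vs p) → ∀ x → ¬ Spanned vs x → Frame
    -- With `x` as the first basis vector, a set spanned by the other three has first coordinate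
    -- zero.
    planar sub x x∉ = contradiction flat
      (no-planar-ovoid (cap-≈ e cap) (anchor-origin (linear-fixes-origin (x ∷ vs) ind) e anchor)
        (trans (size-≈ e) size20))
      where
      ind : Independent (x ∷ vs)
      ind = independent-∷ {vs = vs} indep x∉
      e : S ∘ lin (x ∷ vs) ≈[ linear (x ∷ vs) ind ] S
      e = to-≈
      flat : ∀ p → lin (x ∷ vs) p ∈ₚ S → headIsZero p ≡ true
      flat (s ∷ c) p∈ with ∈-map⁻ (lin vs) {xs = allVecs 3} (sub _ p∈)
      ... | d , _ , eq with lin-injective (x ∷ vs) ind {s ∷ c} {zero ∷ d} (trans eq (sym (lin-skip x vs d)))
      ... | refl = refl
    complete : (∃ λ x → x ∈ₚ S × ¬ Spanned vs x) ⊎ (∀ p → p ∈ₚ S → Spanned vs p) → Frame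
    complete (inj₁ (x , x∈ , x∉)) = spatial x x∈ x∉
    complete (inj₂ sub) =
      -- This vector is drawn from the whole space, whose 81 points exceed the 27 of the span.
      let x , _ , x∉ = new-vector (λ _ → true) vs (ℕₚ.<ᵇ⇒< 27 81 _) in planar sub x x∉
  plane : ∀ {u v} → u ∈ₚ S → v ∈ₚ S → Independent (v ∷ u ∷ []) → Frame
  plane {u} {v} u∈ v∈ indep =
    let w , w∈ , w∉ = new-vector S (v ∷ u ∷ []) (big 9 _)
        indep′ = independent-∷ {vs = v ∷ u ∷ []} indep w∉
    in complete u∈ v∈ w∈ indep′ (spanned-or-new S (w ∷ v ∷ u ∷ []))
  line : ∀ {u} → u ∈ₚ S → Independent (u ∷ []) → Frame
  line {u} u∈ indep =
    let v , v∈ , v∉ = new-vector S (u ∷ []) (big 3 _)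
    in plane u∈ v∈ (independent-∷ {vs = u ∷ []} indep v∉)
  extend : (∃ λ u → u ∈ₚ S × ¬ Spanned [] u) → Frame
  extend (u , u∈ , u∉) = line u∈ (independent-∷ {vs = []} (λ { [] _ → refl }) u∉)

-- Boolean tests

-- The coordinates are the four decimal digits.
pt : ℕ → Point
pt n = digit (n / 1000) ∷ digit (n / 100 % 10) ∷ digit (n / 10 % 10) ∷ digit (n % 10) ∷ []
  where
  digit : ℕ → F3
  digit 0 = zero
  digit 1 = suc zero
  digit _ = suc (suc zero)

pts : List ℕ → List Point
pts = L.map pt

matrix : ℕ → ℕ → ℕ → ℕ → Vec Point 4
matrix a b c d = pt a ∷ pt b ∷ pt c ∷ pt d ∷ []

-- This and a few other tests are opaque, since comparing types that mention them would
-- otherwise unfold them over all points.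
opaque
  sameSet : PSet → PSet → Bool
  sameSet S T = all (λ p → not (S p xor T p)) allPoints

disjointᵇ : List Point → List Point → Bool
disjointᵇ xs ys = all (not ∘ antipodal ys) xs

noLineᵇ : PSet → List Point → Bool
noLineᵇ S ps = all (λ x → all (λ y → (x == y) ∨ not (S (third x y))) ps) ps

isCap : PSet → Bool
isCap S = noLineᵇ S (filterᵇ S allPoints)

isOvoid : List Point → Bool
isOvoid xs = isCap (antipodal xs) ∧ (size (antipodal xs) ≡ᵇ 20) ∧ not (antipodal xs 0ₚ)

opaque
  isIndependent : Vec Point 4 → Bool
  isIndependent vs = all (λ c → not (lin vs c == 0ₚ) ∨ (c == 0ₚ)) allPoints

moves : Vec Point 4 → List Point → List Point → Bool
moves vs xs ys = sameSet (antipodal xs) (antipodal ys ∘ lin vs)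

Family : Set
Family = Vec (List Point) 6

standardizes : List Point → List Point → Vec Point 4 → Bool
standardizes c r vs = moves vs c r ∧ isIndependent vs

isStandardizable : List Point → List (Vec Point 4) → List Point → Bool
isStandardizable c ms r = any (standardizes c r) ms

framesCheck : List Point → List (Vec Point 4) → List (List Point) → Bool
framesCheck c ms frames = all (isStandardizable c ms) frames

opaque
  pairs : (Fin 6 → Fin 6 → Bool) → Bool
  pairs f = all (λ i → all (f i) (allFin 6)) (allFin 6)

isIsometry : List Point → List Point → List Point → Vec Point 4 → Bool
isIsometry c xs ys vs = moves vs xs ys ∧ moves vs c c ∧ isIndependent vs

isometryCheck : List Point → Family → Family → List (Vec Point 4) → Bool
isometryCheck c as bs ms = pairs λ i j →
  any (isIsometry c (V.lookup as zero ++ V.lookup bs zero) (V.lookup as i ++ V.lookup bs j)) ms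

swapCheck : List Point → List Point → List Point → Vec Point 4 → Bool
swapCheck c a b vs = moves vs a b ∧ moves vs b a ∧ moves vs c c ∧ isIndependent vs

anchorCheck : List Point → Bool
anchorCheck c = all (λ p → (p == 0ₚ) ∨
  not (all (λ q → antipodal c (third p q)) (filterᵇ (antipodal c) allPoints))) allPoints

-- No point other than the origin is the anchor of ten points of m.
demicapAnchorCheck : List Point → Bool
demicapAnchorCheck m = all (λ p → (p == 0ₚ) ∨
  (size (λ x → antipodal m x ∧ antipodal m (third p x)) <ᵇ 10)) allPoints

splits : List Point → List (List Point × List Point)
splits [] = ([] , []) ∷ []
splits (x ∷ xs) = concatMap (λ (ys , zs) → (x ∷ ys , zs) ∷ (ys , x ∷ zs) ∷ []) (splits xs)

onLine : List Point → Point → Point → Bool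
onLine xs p x = antipodal xs x ∧ antipodal xs (third p x)

completesLines : List Point → List Point → Bool
completesLines xs ps = all (λ p → any (onLine xs p) allPoints) ps

isExpectedSplit : List Point → List Point → List Point → List Point × List Point → Bool
isExpectedSplit c a b (ys , zs) = not (completesLines ys c ∧ completesLines zs c) ∨
  (sameSet (antipodal ys) (antipodal a) ∧ sameSet (antipodal zs) (antipodal b)) ∨
  (sameSet (antipodal ys) (antipodal b) ∧ sameSet (antipodal zs) (antipodal a))

splitCheck : List Point → List Point → List Point → Bool
splitCheck c a b = all (antipodal c) c ∧ all (antipodal (a ++ b)) (a ++ b) ∧
  all (isExpectedSplit c a b) (splits (a ++ b))

points : List Point → List Point
points xs = xs ++ L.map ⊖_ xs

isCompletion : List Point → Family → List Point → Fin 6 → Bool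
isCompletion a bs r i = sameSet (λ p → mem p r) (antipodal a ∪ₚ antipodal (V.lookup bs i))

completionCheck : List Point → Family → Bool
completionCheck a bs = all (antipodal a) (points a) ∧
  all (λ r → any (isCompletion a bs r) (allFin 6)) (Affine.extensions 20 (points a) allPoints)

crossUnion : Family → Family → Fin 6 → Fin 6 → PSet
crossUnion as bs i j = antipodal (V.lookup bs i) ∪ₚ antipodal (V.lookup as j)

sameIndices : Fin 6 → Fin 6 → Fin 6 → Fin 6 → Bool
sameIndices i j i′ j′ = does (i ≟F i′) ∧ does (j ≟F j′)

distinctUnions : Family → Family → Fin 6 → Fin 6 → Fin 6 → Fin 6 → Bool
distinctUnions as bs i j i′ j′ =
  sameIndices i j i′ j′ ∨ not (sameSet (crossUnion as bs i j) (crossUnion as bs i′ j′))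

distinctCheck : Family → Family → Bool
distinctCheck as bs = pairs λ i j → pairs (distinctUnions as bs i j)

disjointCheck : Family → Family → Bool
disjointCheck as bs = pairs λ i j → disjointᵇ (V.lookup as i) (V.lookup bs j)

ovoidsAvoiding : List Point → List (List Point)
ovoidsAvoiding c = Projective.extensions 10 [] (filterᵇ (not ∘ antipodal c) reps)

partitions : List Point → List Point → List Point → List Point → Bool
partitions c m d e = disjointᵇ m d ∧ disjointᵇ m e ∧ disjointᵇ d e ∧
  all (λ p → mem p c ∨ mem p m ∨ mem p d ∨ mem p e) reps

distinct : List Point → List Point → Bool
distinct xs ys = not (sameSet (antipodal xs) (antipodal ys))

isProduct : Family → Family → List Point → Fin 6 → Fin 6 → Bool
isProduct as bs m i j = sameSet (antipodal m) (antipodal (V.lookup as i ++ V.lookup bs j))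

isListed : Family → Family → List Point → Bool
isListed as bs m = any (λ i → any (isProduct as bs m i) (allFin 6)) (allFin 6)

-- `ds` holds the ovoids found disjoint from both `c` and `m`. Three different ones, each in some
-- partition, refute uniqueness, as a single partition has room for two; so inspecting the first
-- three is enough. Failing on shorter lists certifies that these do not occur.
classified : List Point → Family → Family → List Point → List (List Point) → Bool
classified c as bs m (d₁ ∷ d₂ ∷ []) = isListed as bs m
classified c as bs m ds@(d₁ ∷ d₂ ∷ d₃ ∷ _) =
  distinct d₁ d₂ ∧ distinct d₁ d₃ ∧ distinct d₂ d₃ ∧
  completes d₁ ∧ completes d₂ ∧ completes d₃
  where
  completes : List Point → Bool
  completes d = any (partitions c m d) ds
classified _ _ _ _ _ = false

uniquelyCompleted : List Point → List Point → List (List Point) → Bool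
uniquelyCompleted c m (d₁ ∷ d₂ ∷ []) = partitions c m d₁ d₂
uniquelyCompleted _ _ _ = false

disjointFrom : List Point → List (List Point) → List (List Point)
disjointFrom m = filterᵇ (λ d → disjointᵇ d m)

memberCheck : List Point → Family → Family → List (List Point) → List Point → Bool
memberCheck c as bs ms m = isOvoid m ∧ disjointᵇ c m ∧ classified c as bs m (disjointFrom m ms)

productCheck : List Point → Family → Family → List (List Point) → Fin 6 → Fin 6 → Bool
productCheck c as bs ms i j = isOvoid m ∧ disjointᵇ c m ∧ uniquelyCompleted c m (disjointFrom m ms)
  where
  m : List Point
  m = V.lookup as i ++ V.lookup bs j

ovoidsCheck : List Point → Family → Family → List (List Point) → Bool
ovoidsCheck c as bs ms = all (memberCheck c as bs ms) ms ∧ pairs (productCheck c as bs ms)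

-- Soundness of the tests, and capturing ovoids

all-tabulate : ∀ (P : A → Bool) xs → (∀ x → P x ≡ true) → all P xs ≡ true
all-tabulate P [] h = refl
all-tabulate P (x ∷ xs) h = cong₂ _∧_ (h x) (all-tabulate P xs h)

any-∈ : ∀ (P : A → Bool) {x xs} → x ∈ xs → P x ≡ true → any P xs ≡ true
any-∈ P (here refl) Px rewrite Px = refl
any-∈ P {xs = y ∷ _} (there x∈) Px with P y
... | true = refl
... | false = any-∈ P x∈ Px

¬∨-true : ∀ {b c} → not b ∨ c ≡ true → b ≡ true → c ≡ true
¬∨-true eq refl = eq

opaque
  unfolding sameSet pairs

  sameSet-sound : ∀ {S T} → sameSet S T ≡ true → S ≐ T
  sameSet-sound {S} {T} eq p = agree (all-∈ (λ p → not (S p xor T p)) eq (∈-allVecs p))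
    where
    agree : ∀ {b c} → not (b xor c) ≡ true → b ≡ c
    agree {true} {true} _ = refl
    agree {false} {false} _ = refl

  sameSet-complete : ∀ {S T} → S ≐ T → sameSet S T ≡ true
  sameSet-complete {S} {T} eq = all-tabulate _ allPoints λ p → agree (eq p)
    where
    agree : ∀ {b c} → b ≡ c → not (b xor c) ≡ true
    agree {true} refl = refl
    agree {false} refl = refl

  pairs-∈ : ∀ f → pairs f ≡ true → ∀ i j → f i j ≡ true
  pairs-∈ f eq i j = all-∈ (f i) (all-∈ (λ i → all (f i) (allFin 6)) eq (∈-allFin i)) (∈-allFin j)

antipodal-anchor : ∀ xs → antipodal xs 0ₚ ≡ false → Anchor 0ₚ (antipodal xs)
antipodal-anchor xs 0∉ = (λ 0∈ → true≢false 0∈ 0∉) ,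
  λ b b∈ → trans (cong (antipodal xs) (third-origin b))
    (trans (cong (λ q → mem q xs) (norm-⊖ b)) b∈)

antipodal-++ : ∀ xs ys → antipodal (xs ++ ys) ≐ antipodal xs ∪ₚ antipodal ys
antipodal-++ xs ys p = mem-++ xs
  where
  mem-++ : ∀ xs → mem (norm p) (xs ++ ys) ≡ mem (norm p) xs ∨ mem (norm p) ys
  mem-++ [] = refl
  mem-++ (x ∷ xs) with norm p == x
  ... | true = refl
  ... | false = mem-++ xs

norm-idem : ∀ p → norm (norm p) ≡ norm p
norm-idem p with norm-cases p
... | inj₁ eq = cong norm eq
... | inj₂ eq = trans (cong norm eq) (norm-⊖ p)

disjointᵇ-sound : ∀ xs ys → disjointᵇ xs ys ≡ true → Disjoint (antipodal xs) (antipodal ys)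
disjointᵇ-sound xs ys eq p p∈ p∈′ = true≢false
  (trans (cong (λ q → mem q ys) (norm-idem p)) p∈′)
  (not-true (all-∈ (not ∘ antipodal ys) eq (mem⇒∈ xs p∈)))

disjointᵇ-complete : ∀ {xs ys S T} → All (_∈ₚ S) xs → T ≐ antipodal ys → Disjoint S T →
  disjointᵇ xs ys ≡ true
disjointᵇ-complete {[]} _ _ _ = refl
disjointᵇ-complete {x ∷ _} {ys} (x∈ ∷ xs∈) eq disj = cong₂ _∧_
  (cong not (¬true⇒false (λ x∈T → disj x x∈ (trans (eq x) x∈T))))
  (disjointᵇ-complete {ys = ys} xs∈ eq disj)

isCap-sound : ∀ {S} → isCap S ≡ true → Cap S
isCap-sound {S} eq = third-cap λ x y x≢y x∈ y∈ z∈ →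
  absurd x≢y z∈ (all-∈ (λ y → (x == y) ∨ not (S (third x y)))
    (all-∈ (λ x → all (λ y → (x == y) ∨ not (S (third x y))) members) eq (∈-members x∈)) (∈-members y∈))
  where
  members : List Point
  members = filterᵇ S allPoints
  ∈-members : ∀ {x} → x ∈ₚ S → x ∈ members
  ∈-members x∈ = ∈-filterᵇ⁺ S (∈-allVecs _) x∈
  absurd : ∀ {x y} → x ≢ y → third x y ∈ₚ S → ¬ ((x == y) ∨ not (S (third x y)) ≡ true)
  absurd {x} {y} x≢y z∈ e with ∨-true {x == y} e
  ... | inj₁ x=y = x≢y (==⇒≡ x y x=y)
  ... | inj₂ z∉ = true≢false z∈ (not-true z∉)

record Ovoid (S : PSet) : Set where
  field
    cap    : Cap S
    size20 : size S ≡ 20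
    anchor : Anchor 0ₚ S

open Ovoid

isOvoid-sound : ∀ xs → isOvoid xs ≡ true → Ovoid (antipodal xs)
isOvoid-sound xs eq = let c , rest = ∧-true eq ; s , 0∉ = ∧-true rest in record
  { cap = isCap-sound {antipodal xs} c
  ; size20 = ℕₚ.≡ᵇ⇒≡ _ 20 (≡⇒T s)
  ; anchor = antipodal-anchor xs (not-true 0∉) }

opaque
  unfolding isIndependent

  isIndependent-sound : ∀ {vs} → isIndependent vs ≡ true → Independent vs
  isIndependent-sound {vs} eq c lin≡0 = ==⇒≡ c 0ₚ
    (¬∨-true (all-∈ (λ c → not (lin vs c == 0ₚ) ∨ (c == 0ₚ)) eq (∈-allVecs c))
      (trans (cong (_== 0ₚ) lin≡0) refl))

capture : ∀ c {M} → Ovoid M → Disjoint (antipodal c) M → 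
  ∃ λ m → m ∈ ovoidsAvoiding c × M ≐ antipodal m × All (_∈ₚ M) m
capture c {M} ov disj =
  let m , m∈ , captured = find (Projective.extensions-complete M
        (projectiveBlock-∉ (cap ov) (anchor ov)) 10 [] (filterᵇ outside reps) []
        (trans (count-superset M outside reps M⊆outside) (count-reps (anchor ov) (size20 ov))))
  in m , m∈ , captured⇒antipodal (anchor ov)
       (λ p∈reps p∈ → ∈-filterᵇ⁺ outside p∈reps (M⊆outside _ p∈)) captured , proj₁ captured
  where
  outside : PSet
  outside = not ∘ antipodal c
  M⊆outside : ∀ p → p ∈ₚ M → outside p ≡ true
  M⊆outside p p∈ = cong not (¬true⇒false (λ p∈c → disj p p∈c p∈))

-- Pointwise equal sets need not be equal terms. Read as transport along the identity, `≐` lets the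
-- invariance lemmas replace one set by the other.
identity : Collineation
identity = record
  { to = id ; from = id ; to-from = λ _ → refl ; from-to = λ _ → refl ; to-third = λ _ _ → refl }

≐⇒≈ : ∀ {S T} → S ≐ T → S ≈[ identity ] T
≐⇒≈ eq = pullback eq

ovoid-≈ : ∀ {φ S S′} → FixesOrigin φ → S ≈[ φ ] S′ → Ovoid S′ → Ovoid S
ovoid-≈ fix e ov = record
  { cap = cap-≈ e (cap ov)
  ; size20 = trans (size-≈ e) (size20 ov)
  ; anchor = anchor-origin fix e (anchor ov) }

ovoid-≐ : ∀ {S S′} → S ≐ S′ → Ovoid S′ → Ovoid S
ovoid-≐ eq = ovoid-≈ refl (≐⇒≈ eq)

ovoid-nonempty : ∀ {S} → Ovoid S → ∃ (_∈ₚ S)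
ovoid-nonempty {S} ov = member (filterᵇ S allPoints) (size20 ov)
    (λ p∈ → proj₂ (∈-filterᵇ⁻ S allPoints p∈))
  where
  member : ∀ xs → length xs ≡ 20 → (∀ {p} → p ∈ xs → p ∈ₚ S) → ∃ (_∈ₚ S)
  member (x ∷ _) _ h = x , h (here refl)

-- Partners forming a 1-completable pair with a fixed ovoid

module OneCompletability (bound : ∀ T → Cap T → size T ≤ 20) where

  ovoid⇒maxCap : ∀ {S} → Ovoid S → MaxCap S
  ovoid⇒maxCap ov = cap ov , λ T capT → subst (size T ≤_) (sym (size20 ov)) (bound T capT)

  partitions-sound : ∀ c m d e → Ovoid (antipodal c) → Ovoid (antipodal m) →
    Ovoid (antipodal d) → Ovoid (antipodal e) →
    Disjoint (antipodal c) (antipodal m) → Disjoint (antipodal c) (antipodal d) →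
    Disjoint (antipodal c) (antipodal e) →
    partitions c m d e ≡ true →
    Partition 0ₚ (antipodal c) (antipodal m) (antipodal d) (antipodal e)
  partitions-sound c m d e oc om od oe c-m c-d c-e eq =
    let m-d , rest = ∧-true {disjointᵇ m d} eq
        m-e , rest = ∧-true {disjointᵇ m e} rest
        d-e , cover = ∧-true {disjointᵇ d e} rest
    in (ovoid⇒maxCap oc , ovoid⇒maxCap om , ovoid⇒maxCap od , ovoid⇒maxCap oe) ,
       (anchor oc , anchor om , anchor od , anchor oe) ,
       (c-m , c-d , c-e , disjointᵇ-sound m d m-d , disjointᵇ-sound m e m-e , disjointᵇ-sound d e d-e) ,
       covering cover
    where
    ∨₄ : ∀ {b₁ b₂ b₃ b₄} → b₁ ∨ b₂ ∨ b₃ ∨ b₄ ≡ true →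
      b₁ ≡ true ⊎ b₂ ≡ true ⊎ b₃ ≡ true ⊎ b₄ ≡ true
    ∨₄ {true} _ = inj₁ refl
    ∨₄ {false} {true} _ = inj₂ (inj₁ refl)
    ∨₄ {false} {false} {true} _ = inj₂ (inj₂ (inj₁ refl))
    ∨₄ {false} {false} {false} eq = inj₂ (inj₂ (inj₂ eq))
    covering : all (λ p → mem p c ∨ mem p m ∨ mem p d ∨ mem p e) reps ≡ true →
      ∀ p → p ≡ 0ₚ ⊎ p ∈ₚ antipodal c ⊎ p ∈ₚ antipodal m ⊎ p ∈ₚ antipodal d ⊎ p ∈ₚ antipodal e
    covering cover p with p ≟ₚ 0ₚ
    ... | yes p≡0 = inj₁ p≡0
    ... | no p≢0 = inj₂ (∨₄ (all-∈ (λ p → mem p c ∨ mem p m ∨ mem p d ∨ mem p e) cover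
      (∈-filterᵇ⁺ isRep (∈-allVecs (norm p)) (norm-isRep p p≢0))))

  module Listing (c : List Point) (as bs : Family) (ms : List (List Point))
    (oc : Ovoid (antipodal c))
    (anchor-unique : ∀ a → Anchor a (antipodal c) → a ≡ 0ₚ)
    (captured : ∀ {M} → Ovoid M → Disjoint (antipodal c) M →
      ∃ λ m → m ∈ ms × M ≐ antipodal m × All (_∈ₚ M) m)
    (check : ovoidsCheck c as bs ms ≡ true) where

    maxCap-size : ∀ {S} → MaxCap S → size S ≡ 20
    maxCap-size {S} (capS , max) =
      ℕₚ.≤-antisym (bound S capS) (subst (_≤ size S) (size20 oc) (max (antipodal c) (cap oc)))

    -- Uniqueness in `OneCompletable` ranges over partitions with any anchor. Since that anchor also
    -- belongs to `c`, it is the origin, and every cap of the partition is symmetric about the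
    -- origin.
    maxCap⇒ovoid : ∀ {S a} → MaxCap S → Anchor a (antipodal c) → Anchor a S → Ovoid S
    maxCap⇒ovoid {S} {a} max a-c a-S = record
      { cap = proj₁ max ; size20 = maxCap-size max
      ; anchor = subst (λ b → Anchor b S) (anchor-unique a a-c) a-S }

    member-checked : ∀ {m} → m ∈ ms → memberCheck c as bs ms m ≡ true
    member-checked = all-∈ (memberCheck c as bs ms) (proj₁ (∧-true check))

    member-ovoid : ∀ {m} → m ∈ ms → Ovoid (antipodal m)
    member-ovoid {m} m∈ = isOvoid-sound m (proj₁ (∧-true {isOvoid m} (member-checked m∈)))

    member-disjoint : ∀ {m} → m ∈ ms → Disjoint (antipodal c) (antipodal m)
    member-disjoint {m} m∈ = disjointᵇ-sound c m
      (proj₁ (∧-true {disjointᵇ c m} (proj₂ (∧-true {isOvoid m} (member-checked m∈)))))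

    member-classified : ∀ {m} → m ∈ ms → classified c as bs m (disjointFrom m ms) ≡ true
    member-classified {m} m∈ =
      proj₂ (∧-true {disjointᵇ c m} (proj₂ (∧-true {isOvoid m} (member-checked m∈))))

    ∈-disjointFrom⁻ : ∀ m {d} → d ∈ disjointFrom m ms → d ∈ ms
    ∈-disjointFrom⁻ m d∈ = proj₁ (∈-filterᵇ⁻ (λ d → disjointᵇ d m) ms d∈)

    member-partition : ∀ {m d e} → m ∈ ms → d ∈ ms → e ∈ ms → partitions c m d e ≡ true →
      Partition 0ₚ (antipodal c) (antipodal m) (antipodal d) (antipodal e)
    member-partition {m} {d} {e} m∈ d∈ e∈ = partitions-sound c m d e oc
      (member-ovoid m∈) (member-ovoid d∈) (member-ovoid e∈)
      (member-disjoint m∈) (member-disjoint d∈) (member-disjoint e∈)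

    partition-member : ∀ {a M D E m} → M ≐ antipodal m → Partition a (antipodal c) M D E →
      ∃ λ d → d ∈ disjointFrom m ms × D ≐ antipodal d
    partition-member {m = m} eqM ((_ , _ , maxD , _) , (ac , _ , aD , _) , (_ , cD , _ , mD , _) , _) =
      let d , d∈ , eqD , d⊆ = captured (maxCap⇒ovoid maxD ac aD) cD
      in d , ∈-filterᵇ⁺ (λ d → disjointᵇ d m) d∈
           (disjointᵇ-complete {ys = m} d⊆ eqM (λ p p∈D p∈M → mD p p∈M p∈D)) , eqD

    partition-swap : ∀ {a M D E} → Partition a (antipodal c) M D E → Partition a (antipodal c) M E D
    partition-swap ((mc , mm , md , me) , (ac , am , ad , ae) , (d₁ , d₂ , d₃ , d₄ , d₅ , d₆) , cover) =
      (mc , mm , me , md) , (ac , am , ae , ad) ,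
      (d₁ , d₃ , d₂ , d₅ , d₄ , (λ p e d → d₆ p d e)) ,
      λ p → [ inj₁ , [ inj₂ ∘ inj₁ , [ inj₂ ∘ inj₂ ∘ inj₁ , [ inj₂ ∘ inj₂ ∘ inj₂ ∘ inj₂ ,
        inj₂ ∘ inj₂ ∘ inj₂ ∘ inj₁ ]′ ]′ ]′ ]′ (cover p)

    Listed : PSet → Set
    Listed M = ∃₂ λ i j → M ≐ antipodal (V.lookup as i ++ V.lookup bs j)

    isListed-sound : ∀ {m} → isListed as bs m ≡ true → Listed (antipodal m)
    isListed-sound {m} eq =
      let i , _ , eq₁ = any-∃ (λ i → any (isProduct as bs m i) (allFin 6)) (allFin 6) eq
          j , _ , eq₂ = any-∃ (isProduct as bs m i) (allFin 6) eq₁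
      in i , j , sameSet-sound eq₂

    distinct-sound : ∀ {d e} → distinct d e ≡ true → ¬ antipodal d ≐ antipodal e
    distinct-sound eq same = true≢false (sameSet-complete same) (not-true eq)

    -- By uniqueness each completion of m is D or E, so m has at most two.
    classified-sound : ∀ {m} → m ∈ ms → OneCompletable (antipodal c) (antipodal m) → Listed (antipodal m)
    classified-sound {m} m∈ (_ , D , E , _ , uniq) =
      go (disjointFrom m ms) (∈-disjointFrom⁻ m) (member-classified m∈)
      where
      D-or-E : ∀ {d e} → Partition 0ₚ (antipodal c) (antipodal m) (antipodal d) (antipodal e) →
        antipodal d ≐ D ⊎ antipodal d ≐ E
      D-or-E part with uniq _ _ _ part
      ... | inj₁ (eq , _) = inj₁ eq
      ... | inj₂ (eq , _) = inj₂ eq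
      join : ∀ {S T R : PSet} → S ≐ R → T ≐ R → S ≐ T
      join e e′ p = trans (e p) (sym (e′ p))
      pigeonhole : ∀ {d e f} → antipodal d ≐ D ⊎ antipodal d ≐ E → antipodal e ≐ D ⊎ antipodal e ≐ E →
        antipodal f ≐ D ⊎ antipodal f ≐ E →
        antipodal d ≐ antipodal e ⊎ antipodal d ≐ antipodal f ⊎ antipodal e ≐ antipodal f
      pigeonhole (inj₁ x) (inj₁ y) _ = inj₁ (join x y)
      pigeonhole (inj₂ x) (inj₂ y) _ = inj₁ (join x y)
      pigeonhole (inj₁ x) (inj₂ y) (inj₁ z) = inj₂ (inj₁ (join x z))
      pigeonhole (inj₁ x) (inj₂ y) (inj₂ z) = inj₂ (inj₂ (join y z))
      pigeonhole (inj₂ x) (inj₁ y) (inj₁ z) = inj₂ (inj₂ (join y z))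
      pigeonhole (inj₂ x) (inj₁ y) (inj₂ z) = inj₂ (inj₁ (join x z))
      go : ∀ ds → (∀ {d} → d ∈ ds → d ∈ ms) → classified c as bs m ds ≡ true → Listed (antipodal m)
      go (_ ∷ _ ∷ []) sub eq = isListed-sound {m} eq
      go ds@(d₁ ∷ d₂ ∷ d₃ ∷ _) sub eq =
        let n₁₂ , rest = ∧-true {distinct d₁ d₂} eq
            n₁₃ , rest = ∧-true {distinct d₁ d₃} rest
            n₂₃ , rest = ∧-true {distinct d₂ d₃} rest
            p₁ , rest = ∧-true {any (partitions c m d₁) ds} rest
            p₂ , p₃ = ∧-true {any (partitions c m d₂) ds} rest
        in ⊥-elim ([ distinct-sound {d₁} {d₂} n₁₂ ,
             [ distinct-sound {d₁} {d₃} n₁₃ , distinct-sound {d₂} {d₃} n₂₃ ]′ ]′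
             (pigeonhole {d₁} {d₂} {d₃} (completed (here refl) p₁) (completed (there (here refl)) p₂)
               (completed (there (there (here refl))) p₃)))
        where
        completed : ∀ {d} → d ∈ ds → any (partitions c m d) ds ≡ true →
          antipodal d ≐ D ⊎ antipodal d ≐ E
        completed {d} d∈ eq =
          let e , e∈ , part = any-∃ (partitions c m d) ds eq
          in D-or-E {d} {e} (member-partition m∈ (sub d∈) (sub e∈) part)

    oneCompletable⇒listed : ∀ {M} → MaxCap M → OneCompletable (antipodal c) M → Listed M
    oneCompletable⇒listed {M} max one@(_ , _ , _ , (_ , (ac , aM , _) , (c-M , _) , _) , _) =
      let m , m∈ , eq , _ = captured (maxCap⇒ovoid max ac aM) c-M
          i , j , eq′ = classified-sound m∈
            (oneCompletable-≈ {identity} (pullback λ _ → refl) (pullback λ p → sym (eq p)) one)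
      in i , j , λ p → trans (eq p) (eq′ p)

    product : Fin 6 → Fin 6 → List Point
    product i j = V.lookup as i ++ V.lookup bs j

    product-checked : ∀ i j → productCheck c as bs ms i j ≡ true
    product-checked = pairs-∈ (productCheck c as bs ms) (proj₂ (∧-true {all (memberCheck c as bs ms) ms} check))

    product-ovoid : ∀ i j → Ovoid (antipodal (product i j))
    product-ovoid i j = isOvoid-sound (product i j)
      (proj₁ (∧-true {isOvoid (product i j)} (product-checked i j)))

    product-disjoint : ∀ i j → Disjoint (antipodal c) (antipodal (product i j))
    product-disjoint i j = disjointᵇ-sound c (product i j)
      (proj₁ (∧-true {disjointᵇ c (product i j)} (proj₂ (∧-true {isOvoid (product i j)} (product-checked i j)))))

    listed⇒oneCompletable : ∀ i j → OneCompletable (antipodal c) (antipodal (product i j))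
    listed⇒oneCompletable i j = go (disjointFrom m ms) refl
      (proj₂ (∧-true {disjointᵇ c m} (proj₂ (∧-true {isOvoid m} (product-checked i j)))))
      where
      m : List Point
      m = product i j
      go : ∀ ds → disjointFrom m ms ≡ ds → uniquelyCompleted c m ds ≡ true →
        OneCompletable (antipodal c) (antipodal m)
      go (d ∷ e ∷ []) eq ok = 0ₚ , antipodal d , antipodal e ,
        partitions-sound c m d e oc (product-ovoid i j) (member-ovoid d∈) (member-ovoid e∈)
          (product-disjoint i j) (member-disjoint d∈) (member-disjoint e∈) ok ,
        unique-partition
        where
        d∈ : d ∈ ms
        d∈ = ∈-disjointFrom⁻ m (subst (d ∈_) (sym eq) (here refl))
        e∈ : e ∈ ms
        e∈ = ∈-disjointFrom⁻ m (subst (e ∈_) (sym eq) (there (here refl)))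
        unique-partition : ∀ a D E → Partition a (antipodal c) (antipodal m) D E →
          (D ≐ antipodal d × E ≐ antipodal e) ⊎ (D ≐ antipodal e × E ≐ antipodal d)
        unique-partition a D E part@((_ , _ , maxD , _) , (ac , _ , aD , _) , (_ , _ , _ , _ , _ , D-E) , _) =
          let d′ , d′∈ , eqD = partition-member {m = m} (λ _ → refl) part
              e′ , e′∈ , eqE = partition-member {m = m} (λ _ → refl) (partition-swap part)
          in match (subst (d′ ∈_) eq d′∈) (subst (e′ ∈_) eq e′∈) eqD eqE
          where
          -- `D` and `E` cannot be the same listed ovoid, being disjoint and nonempty.
          clash : ∀ {f} → D ≐ antipodal f → E ≐ antipodal f → ⊥
          clash eqD eqE =
            let p , p∈ = ovoid-nonempty (maxCap⇒ovoid maxD ac aD)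
            in D-E p p∈ (trans (eqE p) (trans (sym (eqD p)) p∈))
          match : ∀ {d′ e′} → d′ ∈ d ∷ e ∷ [] → e′ ∈ d ∷ e ∷ [] → D ≐ antipodal d′ → E ≐ antipodal e′ →
            (D ≐ antipodal d × E ≐ antipodal e) ⊎ (D ≐ antipodal e × E ≐ antipodal d)
          match (here refl) (there (here refl)) eqD eqE = inj₁ (eqD , eqE)
          match (there (here refl)) (here refl) eqD eqE = inj₂ (eqD , eqE)
          match (here refl) (here refl) eqD eqE = ⊥-elim (clash {d} eqD eqE)
          match (there (here refl)) (there (here refl)) eqD eqE = ⊥-elim (clash {e} eqD eqE)

-- Maximal caps containing a demicap, and decompositions into demicaps

completion-sound : ∀ a bs → completionCheck a bs ≡ true → ∀ {M} → Cap M → size M ≡ 20 →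
  antipodal a ⊆ₚ M → ∃ λ i → M ≐ antipodal a ∪ₚ antipodal (V.lookup bs i)
completion-sound a bs check {M} capM size20 a⊆M =
  let seeds , exts = ∧-true {all (antipodal a) (points a)} check
      r , r∈ , r⊆M , M⊆r = find (Affine.extensions-complete M (affineBlock-∉ capM) 20 (points a) allPoints
        (All.tabulate λ x∈ → a⊆M _ (all-∈ (antipodal a) seeds x∈)) size20)
      i , _ , eq = any-∃ (isCompletion a bs r) (allFin 6)
        (all-∈ (λ r → any (isCompletion a bs r) (allFin 6)) exts r∈)
  in i , λ p → trans (bool-ext (λ p∈ → ∈⇒mem (M⊆r p p∈ (inj₂ (∈-allVecs p))))
                               (λ p∈ → All.lookup r⊆M (mem⇒∈ r p∈)))
                     (sameSet-sound {λ p → mem p r} {antipodal a ∪ₚ antipodal (V.lookup bs i)} eq p)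

-- The consequences of a corresponding decomposition that the test of splits can use. They are
-- expressed through `third` and sizes, so they pass along collineations.
record Decomposition (C M S R : PSet) : Set where
  field
    anchorˢ  : ∃ λ a → Anchor a S
    anchorʳ  : ∃ λ a → Anchor a R
    sizeˢ    : size S ≡ 10
    sizeʳ    : size R ≡ 10
    disjoint : Disjoint S R
    union    : M ≐ S ∪ₚ R
    linesˢ   : ∀ p → p ∈ₚ C → ∃ λ x → x ∈ₚ S × third p x ∈ₚ S
    linesʳ   : ∀ p → p ∈ₚ C → ∃ λ x → x ∈ₚ R × third p x ∈ₚ R

open Decomposition

half-one⇒member : ∀ {A : Set} (P : A → Bool) xs → ⌊ length (filterᵇ P xs) /2⌋ ≡ 1 → ∃ λ x → P x ≡ true
half-one⇒member P xs eq = member (filterᵇ P xs) (λ x∈ → proj₂ (∈-filterᵇ⁻ P xs x∈)) eq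
  where
  member : ∀ ys → (∀ {y} → y ∈ ys → P y ≡ true) → ⌊ length ys /2⌋ ≡ 1 → ∃ λ x → P x ≡ true
  member (y ∷ _) h _ = y , h (here refl)

lineCount-one : ∀ S p → lineCount S p ≡ 1 → ∃ λ x → x ∈ₚ S × third p x ∈ₚ S
lineCount-one S p eq =
  let x , ok = half-one⇒member (λ x → S x ∧ S (third p x) ∧ not (does (p ≟ₚ x)) ∧
        not (does (x ≟ₚ third p x)) ∧ not (does (p ≟ₚ third p x))) allPoints eq
      x∈ , rest = ∧-true {S x} ok
  in x , x∈ , proj₁ (∧-true {S (third p x)} rest)

corresponding⇒decomposition : ∀ {C M S R} → CorrespondingDecomposition C M S R → Decomposition C M S R
corresponding⇒decomposition {S = S} {R}
  ((a , _ , anchorS , sizeS , _) , (b , _ , anchorR , sizeR , _) , disj , union , lines , _) = record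
  { anchorˢ = a , anchorS ; anchorʳ = b , anchorR ; sizeˢ = sizeS ; sizeʳ = sizeR
  ; disjoint = disj ; union = union
  ; linesˢ = λ p p∈ → lineCount-one S p (proj₂ (proj₁ (lines p p∈)))
  ; linesʳ = λ p p∈ → lineCount-one R p (proj₂ (proj₂ (lines p p∈))) }

decomposition-≈ : ∀ {φ C C′ M M′ S S′ R R′} → C ≈[ φ ] C′ → M ≈[ φ ] M′ → S ≈[ φ ] S′ → R ≈[ φ ] R′ →
  Decomposition C′ M′ S′ R′ → Decomposition C M S R
decomposition-≈ {φ} {C} {C′} c m s r dec = record
  { anchorˢ = _ , anchor-≈ s (proj₂ (anchorˢ dec))
  ; anchorʳ = _ , anchor-≈ r (proj₂ (anchorʳ dec))
  ; sizeˢ = trans (size-≈ s) (sizeˢ dec)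
  ; sizeʳ = trans (size-≈ r) (sizeʳ dec)
  ; disjoint = disjoint-≈ s r (disjoint dec)
  ; union = ≈-≐ m (≈-∪ s r) (union dec)
  ; linesˢ = λ p p∈ → lines s (linesˢ dec (to φ p) (to-∈ c p∈))
  ; linesʳ = λ p p∈ → lines r (linesʳ dec (to φ p) (to-∈ c p∈)) }
  where
  lines : ∀ {T T′ p} → T ≈[ φ ] T′ → (∃ λ x → x ∈ₚ T′ × third (to φ p) x ∈ₚ T′) →
    ∃ λ x → x ∈ₚ T × third p x ∈ₚ T
  lines {T} {T′} {p} t (x , x∈ , y∈) = from φ x ,
    to-∈ (≈-flip t) x∈ ,
    trans (at t _) (subst (_∈ₚ T′)
      (sym (trans (to-third φ p (from φ x)) (cong (third (to φ p)) (to-from φ x)))) y∈)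

splits-complete : ∀ (S R : PSet) xs → (∀ {x} → x ∈ xs → R x ≡ not (S x)) →
  (filterᵇ S xs , filterᵇ R xs) ∈ splits xs
splits-complete S R [] _ = here refl
splits-complete S R (x ∷ xs) compl with S x | R x | compl (here refl)
... | true | false | _ =
  ∈-concat⁺′ (here refl) (∈-map⁺ _ (splits-complete S R xs (compl ∘ there)))
... | false | true | _ =
  ∈-concat⁺′ (there (here refl)) (∈-map⁺ _ (splits-complete S R xs (compl ∘ there)))

filtered : ∀ {S} xs → Anchor 0ₚ S → S ⊆ₚ antipodal xs → S ≐ antipodal (filterᵇ S xs)
filtered {S} xs anchor sub p = bool-ext
  (λ p∈ → ∈⇒mem (∈-filterᵇ⁺ S (mem⇒∈ xs (sub p p∈)) (trans (norm-∈ anchor p) p∈)))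
  (λ p∈ → trans (sym (norm-∈ anchor p)) (proj₂ (∈-filterᵇ⁻ S xs (mem⇒∈ (filterᵇ S xs) p∈))))

-- The anchors of the two halves are unknown points in the hypothesis and must be shown to be the
-- origin before the halves can be described by representatives. Each of the ten points of `S` has
-- its third point with `a` in `m`, and the test allows that many only at the origin.
demicapAnchor-sound : ∀ m → demicapAnchorCheck m ≡ true → ∀ {S a} → S ⊆ₚ antipodal m →
  size S ≡ 10 → Anchor a S → a ≡ 0ₚ
demicapAnchor-sound m check {S} {a} sub size10 anchor =
  [ ==⇒≡ a 0ₚ , (λ few → contradiction few many) ]′
    (∨-true {a == 0ₚ} (all-∈ (λ p → (p == 0ₚ) ∨ (size (pairedWith p) <ᵇ 10)) check (∈-allVecs a)))
  where
  pairedWith : Point → PSet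
  pairedWith p x = antipodal m x ∧ antipodal m (third p x)
  many : ¬ (size (pairedWith a) <ᵇ 10) ≡ true
  many few = ℕₚ.<⇒≱ (ℕₚ.<ᵇ⇒< _ 10 (≡⇒T few)) (subst (_≤ size (pairedWith a)) size10
    (size-≤ {S} {pairedWith a} id id λ p p∈ → cong₂ _∧_ (sub p p∈) (sub _ (proj₂ anchor p p∈))))

completesLines-complete : ∀ c xs {S} → (∀ p → antipodal c p ≡ true → ∃ λ x → x ∈ₚ S × third p x ∈ₚ S) →
  S ≐ antipodal xs → ∀ ps → (∀ {p} → p ∈ ps → antipodal c p ≡ true) → completesLines xs ps ≡ true
completesLines-complete c xs lines eq [] ps∈ = refl
completesLines-complete c xs lines eq (p ∷ ps) ps∈ =
  let x , x∈ , y∈ = lines p (ps∈ (here refl))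
  in cong₂ _∧_ (any-∈ (onLine xs p) (∈-allVecs x)
                 (cong₂ _∧_ (trans (sym (eq x)) x∈) (trans (sym (eq _)) y∈)))
               (completesLines-complete c xs lines eq ps (ps∈ ∘ there))

splitCheck-sound : ∀ c a b → splitCheck c a b ≡ true → demicapAnchorCheck (a ++ b) ≡ true →
  ∀ {S R} → Decomposition (antipodal c) (antipodal (a ++ b)) S R →
  (S ≐ antipodal a × R ≐ antipodal b) ⊎ (S ≐ antipodal b × R ≐ antipodal a)
splitCheck-sound c a b check anchors {S} {R} dec =
  [ (λ eq → let e , e′ = ∧-true {sameSet (antipodal ys) (antipodal a)} eq
            in inj₁ (link S≐ys (sameSet-sound {antipodal ys} e) , link R≐zs (sameSet-sound {antipodal zs} e′)))
  , (λ eq → let e , e′ = ∧-true {sameSet (antipodal ys) (antipodal b)} eq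
            in inj₂ (link S≐ys (sameSet-sound {antipodal ys} e) , link R≐zs (sameSet-sound {antipodal zs} e′))) ]′
  (∨-true {sameSet (antipodal ys) (antipodal a) ∧ sameSet (antipodal zs) (antipodal b)}
    (¬∨-true (all-∈ (isExpectedSplit c a b)
               (proj₂ (∧-true {all (antipodal m) m} (proj₂ (∧-true {all (antipodal c) c} check))))
               (splits-complete S R m complementary))
      (cong₂ _∧_ (completesLines-complete c ys (linesˢ dec) S≐ys c c∈)
                 (completesLines-complete c zs (linesʳ dec) R≐zs c c∈))))
  where
  m ys zs : List Point
  m = a ++ b
  ys = filterᵇ S m
  zs = filterᵇ R m
  link : ∀ {P Q R : PSet} → P ≐ Q → Q ≐ R → P ≐ R
  link e e′ p = trans (e p) (e′ p)
  S⊆m : S ⊆ₚ antipodal m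
  S⊆m p p∈ = trans (union dec p) (cong (_∨ R p) p∈)
  R⊆m : R ⊆ₚ antipodal m
  R⊆m p p∈ = trans (union dec p) (trans (cong (S p ∨_) p∈) (∨-comm (S p) true))
  anchorS : Anchor 0ₚ S
  anchorS = let _ , anc = anchorˢ dec in
    subst (λ o → Anchor o S) (demicapAnchor-sound m anchors S⊆m (sizeˢ dec) anc) anc
  anchorR : Anchor 0ₚ R
  anchorR = let _ , anc = anchorʳ dec in
    subst (λ o → Anchor o R) (demicapAnchor-sound m anchors R⊆m (sizeʳ dec) anc) anc
  S≐ys : S ≐ antipodal ys
  S≐ys = filtered m anchorS S⊆m
  R≐zs : R ≐ antipodal zs
  R≐zs = filtered m anchorR R⊆m
  c∈ : ∀ {p} → p ∈ c → antipodal c p ≡ true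
  c∈ = all-∈ (antipodal c) (proj₁ (∧-true {all (antipodal c) c} check))
  complementary : ∀ {x} → x ∈ m → R x ≡ not (S x)
  complementary {x} x∈m = exclusive
    (trans (sym (union dec x)) (all-∈ (antipodal m)
      (proj₁ (∧-true {all (antipodal m) m} (proj₂ (∧-true {all (antipodal c) c} check)))) x∈m))
    (disjoint dec x)
    where
    exclusive : ∀ {b d} → b ∨ d ≡ true → (b ≡ true → d ≢ true) → d ≡ not b
    exclusive {true} _ disj = ¬true⇒false (disj refl)
    exclusive {false} eq _ = eq

∪-comm : ∀ S T → S ∪ₚ T ≐ T ∪ₚ S
∪-comm S T p = ∨-comm (S p) (T p)

same-indices : ∀ {i j i′ j′} → sameIndices i j i′ j′ ≡ true → (i , j) ≡ (i′ , j′)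
same-indices {i} {j} {i′} {j′} eq with i ≟F i′ | j ≟F j′
... | yes refl | yes refl = refl

-- The conclusion for the standard caps

module Standard (c : List Point) (as bs : Family)
  (c-ovoid : isOvoid c ≡ true) (c-anchor : anchorCheck c ≡ true)
  (ovoids-ok : ovoidsCheck c as bs (ovoidsAvoiding c) ≡ true)
  (disjoint-ok : disjointCheck as bs ≡ true) (distinct-ok : distinctCheck as bs ≡ true)
  (completion-ok : completionCheck (V.lookup as zero) bs ≡ true)
  (completion-ok′ : completionCheck (V.lookup bs zero) as ≡ true)
  (bound : ∀ T → Cap T → size T ≤ 20) where

  a b : Fin 6 → PSet
  a i = antipodal (V.lookup as i)
  b i = antipodal (V.lookup bs i)

  anchor-unique : ∀ p → Anchor p (antipodal c) → p ≡ 0ₚ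
  anchor-unique p (_ , closed) =
    [ ==⇒≡ p 0ₚ , (λ open′ → contradiction (not-true open′) (true≢false closed′)) ]′
      (∨-true {p == 0ₚ} (all-∈ (λ p → (p == 0ₚ) ∨ not (closedᵇ p)) c-anchor (∈-allVecs p)))
    where
    closedᵇ : Point → Bool
    closedᵇ p = all (λ q → antipodal c (third p q)) (filterᵇ (antipodal c) allPoints)
    closed′ : closedᵇ p ≡ true
    closed′ = all-∈⁺ (filterᵇ (antipodal c) allPoints)
      (λ q q∈ → closed q (proj₂ (∈-filterᵇ⁻ (antipodal c) allPoints q∈)))
      where
      all-∈⁺ : ∀ qs → (∀ q → q ∈ qs → antipodal c (third p q) ≡ true) →
        all (λ q → antipodal c (third p q)) qs ≡ true
      all-∈⁺ [] h = refl
      all-∈⁺ (q ∷ qs) h = cong₂ _∧_ (h q (here refl)) (all-∈⁺ qs (λ q → h q ∘ there))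

  open OneCompletability bound

  module Partners = OneCompletability.Listing bound c as bs (ovoidsAvoiding c)
    (isOvoid-sound c c-ovoid) anchor-unique (capture c) ovoids-ok

  -- The indices swap because `b` plays the role of the `Rs` and `a` that of the `Cs`, while a
  -- product lists the member of `as` before that of `bs`.
  crossing : ∀ i j → b i ∪ₚ a j ≐ antipodal (Partners.product j i)
  crossing i j p = trans (∪-comm (b i) (a j) p) (sym (antipodal-++ (V.lookup as j) (V.lookup bs i) p))

  crossing-ovoid : ∀ i j → Ovoid (b i ∪ₚ a j)
  crossing-ovoid i j = ovoid-≐ (crossing i j) (Partners.product-ovoid j i)

  crossing-distinct : ∀ i j i′ j′ → (i , j) ≢ (i′ , j′) → ¬ b i ∪ₚ a j ≐ b i′ ∪ₚ a j′
  crossing-distinct i j i′ j′ ne same =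
    [ ne ∘ same-indices {i} {j}
    , (λ eq → true≢false (sameSet-complete {crossUnion as bs i j} {crossUnion as bs i′ j′} same) (not-true eq)) ]′
    (∨-true {sameIndices i j i′ j′}
      (pairs-∈ (distinctUnions as bs i j)
        (pairs-∈ (λ i j → pairs (distinctUnions as bs i j)) distinct-ok i j) i′ j′))

  a-b-disjoint : ∀ i j → Disjoint (a i) (b j)
  a-b-disjoint i j = disjointᵇ-sound (V.lookup as i) (V.lookup bs j)
    (pairs-∈ (λ i j → disjointᵇ (V.lookup as i) (V.lookup bs j)) disjoint-ok i j)

  six-b : SixCompletions (a zero) (b zero) b
  six-b = (λ _ → refl) ,
    (λ i → ovoid⇒maxCap (ovoid-≐ (∪-comm (a zero) (b i)) (crossing-ovoid i zero)) , a-b-disjoint zero i) ,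
    (λ i j i≢j eq → crossing-distinct i zero j zero (i≢j ∘ cong proj₁) (λ p → cong (_∨ a zero p) (eq p))) ,
    λ M max sub → completion-sound (V.lookup as zero) bs completion-ok (proj₁ max) (Partners.maxCap-size max) sub

  six-a : SixCompletions (b zero) (a zero) a
  six-a = (λ _ → refl) ,
    (λ i → ovoid⇒maxCap (crossing-ovoid zero i) , λ p p∈b p∈a → a-b-disjoint i zero p p∈a p∈b) ,
    (λ i j i≢j eq → crossing-distinct zero i zero j (i≢j ∘ cong proj₂) (λ p → cong (b zero p ∨_) (eq p))) ,
    λ M max sub → completion-sound (V.lookup bs zero) as completion-ok′ (proj₁ max) (Partners.maxCap-size max) sub

  conclusion : Conclusion (antipodal c) (a zero) (b zero)
  conclusion = b , a , six-b , six-a ,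
    (λ i j → ovoid⇒maxCap (crossing-ovoid i j)) ,
    crossing-distinct ,
    (λ M max one → let i , j , eq = Partners.oneCompletable⇒listed max one in
      j , i , λ p → trans (eq p) (sym (crossing j i p))) ,
    λ i j → oneCompletable-≈ {identity} (≐⇒≈ λ _ → refl) (≐⇒≈ (crossing i j)) (Partners.listed⇒oneCompletable j i)

-- The standard data and the evaluation of the tests

opaque
  unfolding sameSet pairs isIndependent Projective.extensions Affine.extensions

  -- The data come from a computer search. The unions of a member of as and a member of bs are
  -- the ovoids that form a 1-completable pair with c₀.
  c₀ : List Point
  c₀ = pts (0001 ∷ 0010 ∷ 0100 ∷ 0111 ∷ 1000 ∷ 1011 ∷ 1102 ∷ 1120 ∷ 1212 ∷ 1221 ∷ [])

  as bs : Family
  as = map pts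
    ( (0011 ∷ 1101 ∷ 1121 ∷ 1201 ∷ 1202 ∷ [])
    ∷ (0011 ∷ 1110 ∷ 1112 ∷ 1210 ∷ 1220 ∷ [])
    ∷ (0101 ∷ 1001 ∷ 1101 ∷ 1111 ∷ 1112 ∷ [])
    ∷ (0101 ∷ 1010 ∷ 1200 ∷ 1202 ∷ 1210 ∷ [])
    ∷ (0110 ∷ 1001 ∷ 1200 ∷ 1201 ∷ 1220 ∷ [])
    ∷ (0110 ∷ 1010 ∷ 1110 ∷ 1111 ∷ 1121 ∷ []) ∷ [])
  bs = map pts
    ( (0012 ∷ 0102 ∷ 0112 ∷ 1020 ∷ 1021 ∷ [])
    ∷ (0012 ∷ 0120 ∷ 0121 ∷ 1002 ∷ 1012 ∷ [])
    ∷ (0102 ∷ 0120 ∷ 0122 ∷ 1122 ∷ 1222 ∷ [])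
    ∷ (0112 ∷ 0121 ∷ 0122 ∷ 1100 ∷ 1211 ∷ [])
    ∷ (1002 ∷ 1020 ∷ 1022 ∷ 1122 ∷ 1211 ∷ [])
    ∷ (1012 ∷ 1021 ∷ 1022 ∷ 1100 ∷ 1222 ∷ []) ∷ [])

  -- These move c₀ to all 24 ovoids through the standard basis.
  monomials : List (Vec Point 4)
  monomials = concatMap (λ x → concatMap (λ y → concatMap (λ z → rotations (pt x) (pt y) (pt z))
    (0010 ∷ 0020 ∷ [])) (0100 ∷ 0200 ∷ [])) (1000 ∷ 2000 ∷ [])
    where
    rotations : Point → Point → Point → List (Vec Point 4)
    rotations x y z =
      -- Eight sign patterns and three rotations make 24 matrices. The last sign stays constant
      -- because a matrix and its negative act alike on symmetric sets.
      (x ∷ y ∷ z ∷ pt 0001 ∷ []) ∷ (y ∷ z ∷ x ∷ pt 0001 ∷ []) ∷ (z ∷ x ∷ y ∷ pt 0001 ∷ []) ∷ []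

  -- Products of a matrix moving the first member of as to any other by one that fixes it and
  -- moves the first member of bs to any other.
  isometries : List (Vec Point 4)
  isometries = concatMap (λ t → L.map (map (lin t)) us) ts
    where
    ts us : List (Vec Point 4)
    ts = matrix 0100 1000 0010 0001 ∷ matrix 0100 1000 0001 0010 ∷ matrix 0010 1120 0100 0001
       ∷ matrix 0001 1102 0010 1000 ∷ matrix 0001 1102 0010 0100 ∷ matrix 0001 1102 0100 0010 ∷ []
    us = matrix 1000 0100 0010 0001 ∷ matrix 0100 1000 0010 0001 ∷ matrix 0010 2000 0100 0222
       ∷ matrix 0001 2000 0222 0100 ∷ matrix 0010 0200 1000 2022 ∷ matrix 0001 0200 2022 1000 ∷ []

  interchange : Vec Point 4
  interchange = matrix 0001 1000 2210 1011

  c₀-ovoid : isOvoid c₀ ≡ true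
  c₀-ovoid = refl

  c₀-anchor : anchorCheck c₀ ≡ true
  c₀-anchor = refl

  frames-ok : framesCheck c₀ monomials (Projective.extensions 10 standardBasis reps) ≡ true
  frames-ok = refl

  isometries-ok : isometryCheck c₀ as bs isometries ≡ true
  isometries-ok = refl

  interchange-ok : swapCheck c₀ (V.lookup as zero) (V.lookup bs zero) interchange ≡ true
  interchange-ok = refl

  ovoids-ok : ovoidsCheck c₀ as bs (ovoidsAvoiding c₀) ≡ true
  ovoids-ok = refl

  disjoint-ok : disjointCheck as bs ≡ true
  disjoint-ok = refl

  distinct-ok : distinctCheck as bs ≡ true
  distinct-ok = refl

  a-completions-ok : completionCheck (V.lookup as zero) bs ≡ true
  a-completions-ok = refl

  b-completions-ok : completionCheck (V.lookup bs zero) as ≡ true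
  b-completions-ok = refl

  anchors-ok : demicapAnchorCheck (V.lookup as zero ++ V.lookup bs zero) ≡ true
  anchors-ok = refl

  split-ok : splitCheck c₀ (V.lookup as zero) (V.lookup bs zero) ≡ true
  split-ok = refl

-- Reduction to the standard caps

≈-trans : ∀ {φ ψ S S′ S″} → S ≈[ φ ] S′ → S′ ≈[ ψ ] S″ → S ≈[ ψ ⊚ φ ] S″
≈-trans {φ} e e′ .at p = trans (at e p) (at e′ (to φ p))

opaque
  -- A single `φ` precedes the quantification over `xs` and `ys`, so that one matrix can be seen to
  -- move several sets at once, in particular a partner while fixing `c₀`.
  moves-sound : ∀ {vs} → isIndependent vs ≡ true → ∃ λ φ → ∀ xs ys → moves vs xs ys ≡ true →
    antipodal xs ≈[ φ ] antipodal ys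
  moves-sound {vs} indep = linear vs (isIndependent-sound {vs} indep) , λ xs ys eq →
    pullback (sameSet-sound {antipodal xs} {antipodal ys ∘ lin vs} eq)

size-∪ : ∀ S T → Disjoint S T → size (S ∪ₚ T) ≡ size S + size T
size-∪ S T disj = count-⊎ {S = S ∪ₚ T} {P = S} {Q = T} (λ _ → refl) disj allPoints

disjoint-∪ : ∀ {S T U} → Disjoint S T → Disjoint S U → Disjoint S (T ∪ₚ U)
disjoint-∪ {T = T} S-T S-U p p∈S p∈ = [ S-T p p∈S , S-U p p∈S ]′ (∨-true {T p} p∈)

partition-size : ∀ {C M D E} → Partition 0ₚ C M D E → size C ≡ 20
partition-size {C} {M} {D} {E} ((mC , mM , mD , mE) , ((0∉C , _) , (0∉M , _) , (0∉D , _) , (0∉E , _)) ,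
  (C-M , C-D , C-E , M-D , M-E , D-E) , cover) =
  ℕₚ.*-cancelˡ-≡ (size C) 20 4 (begin
    size C + (size C + (size C + (size C + 0)))
      ≡⟨ cong (λ m → size C + (size C + (size C + m))) (ℕₚ.+-identityʳ (size C)) ⟩
    size C + (size C + (size C + size C))
      ≡⟨ cong₂ (λ m n → size C + (m + n)) (same mC mM) (cong₂ _+_ (same mC mD) (same mC mE)) ⟩
    size C + (size M + (size D + size E))
      ≡⟨ cong (λ m → size C + (size M + m)) (size-∪ D E D-E) ⟨
    size C + (size M + size (D ∪ₚ E))
      ≡⟨ cong (size C +_) (size-∪ M (D ∪ₚ E) (disjoint-∪ {M} {D} {E} M-D M-E)) ⟨
    size C + size (M ∪ₚ (D ∪ₚ E))
      ≡⟨ size-∪ C (M ∪ₚ (D ∪ₚ E)) (disjoint-∪ {C} {M} {D ∪ₚ E} C-M (disjoint-∪ {C} {D} {E} C-D C-E)) ⟨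
    size (C ∪ₚ (M ∪ₚ (D ∪ₚ E)))
      ≡⟨ count-cong nonzero-∪ allPoints ⟨
    size nonzero
      ≡⟨⟩
    80 ∎)
  where
  open ≡-Reasoning
  same : ∀ {S T} → MaxCap S → MaxCap T → size S ≡ size T
  same {S} {T} (capS , maxS) (capT , maxT) = ℕₚ.≤-antisym (maxT S capS) (maxS T capT)
  nonzero : PSet
  nonzero p = not (p == 0ₚ)
  ∉0 : ∀ {S : PSet} {p} → 0ₚ ∉ₚ S → p ∈ₚ S → not (p == 0ₚ) ≡ true
  ∉0 {S} {p} 0∉ p∈ = cong not (¬true⇒false λ eq → 0∉ (subst (_∈ₚ S) (==⇒≡ p 0ₚ eq) p∈))
  nonzero-∪ : ∀ p → nonzero p ≡ C p ∨ (M p ∨ (D p ∨ E p))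
  nonzero-∪ p = bool-ext
    (λ p≢0 → [ (λ p≡0 → contradiction (not-true p≢0) (true≢false (trans (cong (_== 0ₚ) p≡0) refl))) ,
      [ ∨-left , [ ∨-right (C p) ∘ ∨-left , [ ∨-right (C p) ∘ ∨-right (M p) ∘ ∨-left ,
        ∨-right (C p) ∘ ∨-right (M p) ∘ ∨-right (D p) ]′ ]′ ]′ ]′ (cover p))
    ([ ∉0 {C} 0∉C , [ ∉0 {M} 0∉M , [ ∉0 {D} 0∉D , ∉0 {E} 0∉E ]′ ∘ ∨-true ]′ ∘ ∨-true ]′ ∘ ∨-true)
    where
    ∨-left : ∀ {b c} → b ≡ true → b ∨ c ≡ true
    ∨-left refl = refl
    ∨-right : ∀ b {c} → c ≡ true → b ∨ c ≡ true
    ∨-right true _ = refl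
    ∨-right false eq = eq

framed-ovoids : List (List Point)
framed-ovoids = Projective.extensions 10 standardBasis reps

opaque
  capture-framed : ∀ {S} → Ovoid S → All (_∈ₚ S) standardBasis → ∃ λ r → r ∈ framed-ovoids × S ≐ antipodal r
  capture-framed {S} ov basis∈ =
    let r , r∈ , r⊆S , S⊆r = find (Projective.extensions-complete S
          (projectiveBlock-∉ (cap ov) (anchor ov)) 10 standardBasis reps basis∈
          (count-reps (anchor ov) (size20 ov)))
    in r , r∈ , captured⇒antipodal (anchor ov) {reps} {r} (λ p∈ _ → p∈)
         (r⊆S , λ p p∈ → [ (λ ()) , S⊆r p p∈ ∘ inj₂ ]′)

opaque
  standardizes-sound : ∀ r vs → standardizes c₀ r vs ≡ true → ∃ λ φ → antipodal c₀ ≈[ φ ] antipodal r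
  standardizes-sound r vs eq =
    let φ , moved = moves-sound {vs} (proj₂ (∧-true {moves vs c₀ r} eq))
    in φ , moved c₀ r (proj₁ (∧-true {moves vs c₀ r} eq))

opaque
  framed-standardizable : ∀ r → r ∈ framed-ovoids → isStandardizable c₀ monomials r ≡ true
  framed-standardizable r = all-∈ (isStandardizable c₀ monomials) {x = r} {xs = framed-ovoids} frames-ok

opaque
  isStandardizable-sound : ∀ r → isStandardizable c₀ monomials r ≡ true →
    ∃ λ φ → antipodal c₀ ≈[ φ ] antipodal r
  isStandardizable-sound r eq =
    let vs , _ , eq = any-∃ (standardizes c₀ r) monomials eq in standardizes-sound r vs eq

opaque
  framed-standard : ∀ r → r ∈ framed-ovoids → ∃ λ φ → antipodal c₀ ≈[ φ ] antipodal r
  framed-standard r r∈ = isStandardizable-sound r (framed-standardizable r r∈)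

opaque
  to-standard-ovoid : ∀ {S} → Ovoid S → ∃ λ φ → antipodal c₀ ≈[ φ ] S
  to-standard-ovoid {S} ov = framed (frame (cap ov) (anchor ov) (size20 ov))
    where
    framed : (∃ λ φ → FixesOrigin φ × All (λ e → to φ e ∈ₚ S) standardBasis) → ∃ λ φ → antipodal c₀ ≈[ φ ] S
    framed (φ , fixes , basis∈) =
      let r , r∈ , S≐r = capture-framed {S ∘ to φ} (ovoid-≈ {φ} {S ∘ to φ} {S} fixes (to-≈ {φ} {S}) ov) basis∈
          ψ , e = framed-standard r r∈
      in φ ⊚ ψ , ≈-trans {ψ} {φ} {antipodal c₀} {antipodal r} {S} e (pullback λ p → sym (S≐r p))

a₀ b₀ : List Point
a₀ = V.lookup as zero
b₀ = V.lookup bs zero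

product : Fin 6 → Fin 6 → List Point
product i j = V.lookup as i ++ V.lookup bs j

opaque
  isIsometry-sound : ∀ m vs → isIsometry c₀ (a₀ ++ b₀) m vs ≡ true → ∃ λ φ →
    antipodal (a₀ ++ b₀) ≈[ φ ] antipodal m × antipodal c₀ ≈[ φ ] antipodal c₀
  isIsometry-sound m vs eq =
    let onto , rest = ∧-true {moves vs (a₀ ++ b₀) m} eq
        fixed , indep = ∧-true {moves vs c₀ c₀} rest
        φ , moved = moves-sound {vs} indep
    in φ , moved (a₀ ++ b₀) m onto , moved c₀ c₀ fixed

opaque
  hasIsometry : ∀ i j → any (isIsometry c₀ (a₀ ++ b₀) (product i j)) isometries ≡ true
  hasIsometry = pairs-∈ (λ i j → any (isIsometry c₀ (a₀ ++ b₀) (product i j)) isometries) isometries-ok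

opaque
  to-standard-product : ∀ i j → ∃ λ φ →
    antipodal (a₀ ++ b₀) ≈[ φ ] antipodal (product i j) × antipodal c₀ ≈[ φ ] antipodal c₀
  to-standard-product i j =
    let vs , _ , eq = any-∃ (isIsometry c₀ (a₀ ++ b₀) (product i j)) isometries (hasIsometry i j)
    in isIsometry-sound (product i j) vs eq

opaque
  interchanging : ∃ λ φ → antipodal a₀ ≈[ φ ] antipodal b₀ × antipodal b₀ ≈[ φ ] antipodal a₀ ×
    antipodal c₀ ≈[ φ ] antipodal c₀
  interchanging =
    let a→b , rest = ∧-true {moves interchange a₀ b₀} interchange-ok
        b→a , rest = ∧-true {moves interchange b₀ a₀} rest
        fixed , indep = ∧-true {moves interchange c₀ c₀} rest
        φ , moved = moves-sound {interchange} indep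
    in φ , moved a₀ b₀ a→b , moved b₀ a₀ b→a , moved c₀ c₀ fixed

module _ {C C′ C₁ R₁ : PSet} (bound : ∀ T → Cap T → size T ≤ 20)
  (dec : Decomposition C C′ C₁ R₁) where

  open Standard c₀ as bs c₀-ovoid c₀-anchor ovoids-ok disjoint-ok distinct-ok
    a-completions-ok b-completions-ok bound

  conclude : ∀ φ → antipodal c₀ ≈[ φ ] C → antipodal (a₀ ++ b₀) ≈[ φ ] C′ → Conclusion C C₁ R₁
  conclude φ c m = by-cases (splitCheck-sound c₀ a₀ b₀ split-ok anchors-ok
      (decomposition-≈ {φ} c m (to-≈ {φ} {C₁}) (to-≈ {φ} {R₁}) dec))
    where
    pulled : ∀ {S} xs → S ∘ to φ ≐ antipodal xs → antipodal xs ≈[ φ ] S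
    pulled xs eq .at p = sym (eq p)
    conclude-at : ∀ χ → antipodal c₀ ≈[ χ ] C → antipodal a₀ ≈[ χ ] C₁ → antipodal b₀ ≈[ χ ] R₁ →
      Conclusion C C₁ R₁
    conclude-at χ c a b = conclusion-≈ {χ ⁻¹} {C} {antipodal c₀} {C₁} {antipodal a₀} {R₁} {antipodal b₀}
      (≈-flip c) (≈-flip a) (≈-flip b) conclusion
    by-cases : (C₁ ∘ to φ ≐ antipodal a₀ × R₁ ∘ to φ ≐ antipodal b₀) ⊎
               (C₁ ∘ to φ ≐ antipodal b₀ × R₁ ∘ to φ ≐ antipodal a₀) → Conclusion C C₁ R₁
    by-cases (inj₁ (C₁≐a , R₁≐b)) = conclude-at φ c (pulled a₀ C₁≐a) (pulled b₀ R₁≐b)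
    -- The halves come out in the opposite order; precomposing with the interchange restores it.
    by-cases (inj₂ (C₁≐b , R₁≐a)) =
      let σ , a→b , b→a , c→c = interchanging
      in conclude-at (φ ⊚ σ) (≈-trans c→c c) (≈-trans a→b (pulled b₀ C₁≐b)) (≈-trans b→a (pulled a₀ R₁≐a))

  -- The map bringing the partner into standard position is an isometry of `c₀`, so composing with
  -- it does not disturb the position already reached by `C`.
  from-standard-ovoid : ∀ φ → antipodal c₀ ≈[ φ ] C → MaxCap C′ → OneCompletable C C′ → Conclusion C C₁ R₁
  from-standard-ovoid φ c max one =
    listed (Partners.oneCompletable⇒listed (maxCap-≈ (to-≈ {φ} {C′}) max) (oneCompletable-≈ c (to-≈ {φ} {C′}) one))
    where
    listed : (∃₂ λ i j → C′ ∘ to φ ≐ antipodal (product i j)) → Conclusion C C₁ R₁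
    listed (i , j , eq) =
      let ψ , onto , fixed = to-standard-product i j
      in conclude (φ ⊚ ψ) (≈-trans fixed c)
           (≈-trans onto (pullback {antipodal (product i j)} {φ} {C′} λ p → sym (eq p)))

theorem5p1 : ∀ (C C' C₁ R₁ : PSet) →
    MaxCap C → MaxCap C' → OneCompletable C C' →
    CorrespondingDecomposition C C' C₁ R₁ →
    Σ (Fin 6 → PSet) λ Rs → Σ (Fin 6 → PSet) λ Cs →
    SixCompletions C₁ R₁ Rs × SixCompletions R₁ C₁ Cs ×
    (∀ i j → MaxCap (Rs i ∪ₚ Cs j)) ×
    (∀ i j i' j' → (i , j) ≢ (i' , j') →
    ¬ (Rs i ∪ₚ Cs j ≐ Rs i' ∪ₚ Cs j')) ×
    (∀ M → MaxCap M → OneCompletable C M →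
    Σ (Fin 6) λ i → Σ (Fin 6) λ j → M ≐ Rs i ∪ₚ Cs j) ×
    (∀ i j → OneCompletable C (Rs i ∪ₚ Cs j))
theorem5p1 C C' C₁ R₁ maxC maxC' one@(a , D , E , part , _) dec =
  let φ , e = to-standard-ovoid {C ∘ to τ} ovoid
  in from-standard-ovoid bound (corresponding⇒decomposition dec) (τ ⊚ φ)
       (≈-trans e (to-≈ {τ} {C})) maxC' one
  where
  τ : Collineation
  τ = translation a
  part₀ : Partition 0ₚ (C ∘ to τ) (C' ∘ to τ) (D ∘ to τ) (E ∘ to τ)
  -- The translation by `a` carries the anchor `a` back to `a ⊕ ⊖ a`.
  part₀ = subst (λ o → Partition o (C ∘ to τ) (C' ∘ to τ) (D ∘ to τ) (E ∘ to τ)) (⊖-self a)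
    (partition-≈ (to-≈ {τ} {C}) (to-≈ {τ} {C'}) (to-≈ {τ} {D}) (to-≈ {τ} {E}) part)
  ovoid : Ovoid (C ∘ to τ)
  ovoid = record
    { cap = proj₁ (proj₁ (proj₁ part₀))
    ; size20 = partition-size part₀
    ; anchor = proj₁ (proj₁ (proj₂ part₀)) }
  bound : ∀ T → Cap T → size T ≤ 20
  -- Maximality of `C` bounds every cap by the size of `C`, which its translate shows to be 20.
  bound T capT = subst (size T ≤_) (trans (sym (size-≈ (to-≈ {τ} {C}))) (size20 ovoid)) (proj₂ maxC T capT)
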